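{- Let $T(k,n)$, for integers $n\ge1$ and $0\le k\le n$, denote the number of permutations $\alpha\in S_n$ with $H(\alpha\beta,\beta\alpha)=k$ where $\beta$ is an $n$-cycle in $S_n$. Then, as formal power series, \[ \sum_{n,k}T(k,n)\frac{z^n}{n!}u^k = z e^{z(1-u)}\Big(\big(1-\log(1-zu)\big)(1-u)+\frac{u}{1-zu}\Big). \]
   Context: $S_n$ is the symmetric group on $[n]$; $H(\sigma,\tau)=|\{a:\sigma(a)\ne\tau(a)\}|$ is the Hamming metric. $T(k,n)$ does not depend on the chosen $n$-cycle. -}

module Defs where

open import Data.Nat as ℕ using (ℕ; zero; suc; NonZero)
open import Data.Nat.Properties using (_!≢0)
open import Data.Nat.DivMod using (_%_; m%n<n)
open import Data.Nat using (_!)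
open import Data.Fin as Fin using (Fin; toℕ; fromℕ<)
open import Data.Fin.Properties using (all?; _≟_)
open import Data.Vec as Vec using (Vec; []; _∷_; lookup)
open import Data.List as List using (List; []; _∷_; [_]; concatMap; allFin; filter; length)
open import Data.Product using (_×_)
open import Data.Integer as ℤ using (+_)
open import Data.Rational as ℚ using (ℚ; 0ℚ; 1ℚ; _+_; _*_; -_; _/_)
open import Relation.Binary.PropositionalEquality using (_≡_; _≢_)
open import Relation.Nullary using (¬_; Dec)
open import Relation.Nullary.Decidable using (_×-dec_; ¬?)

IsPerm : ∀ {n} → (Fin n → Fin n) → Set
IsPerm {n} f = (i j : Fin n) → f i ≡ f j → i ≡ j   -- injective ⇔ bijective on Fin n

isPerm? : ∀ {n} (f : Fin n → Fin n) → Dec (IsPerm f)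
isPerm? f = all? (λ i → all? (λ j → Dec-imp (f i ≟ f j) (i ≟ j)))
  where
  open import Relation.Nullary.Decidable using (_→-dec_)
  Dec-imp = _→-dec_

-- all functions Fin m → Fin n, as vectors of values
allVecs : ∀ m n → List (Vec (Fin n) m)
allVecs zero    n = [ [] ]
allVecs (suc m) n = concatMap (λ x → List.map (x ∷_) (allVecs m n)) (allFin n)

H : ∀ {n} → (Fin n → Fin n) → (Fin n → Fin n) → ℕ
H {n} σ τ = length (filter (λ a → ¬? (σ a ≟ τ a)) (allFin n))

cyc : ∀ {n} → Fin n → Fin n
cyc {suc m} i = fromℕ< (m%n<n (suc (toℕ i)) (suc m))

_∘ₚ_ : ∀ {n} → (Fin n → Fin n) → (Fin n → Fin n) → (Fin n → Fin n)
(α ∘ₚ β) a = α (β a)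

T : ℕ → ℕ → ℕ
T k n = length (filter (λ v → isPerm? (lookup v) ×-dec (H (lookup v ∘ₚ cyc) (cyc ∘ₚ lookup v) ℕ.≟ k))
                       (allVecs n n))

-- Formal power series in z,u over ℚ: f n k = coefficient of z^n u^k.

FPS : Set
FPS = ℕ → ℕ → ℚ

Σ≤ : ℕ → (ℕ → ℚ) → ℚ
Σ≤ zero    f = f 0
Σ≤ (suc n) f = Σ≤ n f + f (suc n)

const : ℚ → FPS
const c zero zero = c
const c _    _    = 0ℚ

𝟙 : FPS
𝟙 = const 1ℚ

z : FPS
z 1 0 = 1ℚ
z _ _ = 0ℚ

u : FPS
u 0 1 = 1ℚ
u _ _ = 0ℚ

_⊕_ : FPS → FPS → FPS
(f ⊕ g) n k = f n k + g n k

_⊖_ : FPS → FPS → FPS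
(f ⊖ g) n k = f n k + - g n k

_⊗_ : FPS → FPS → FPS
(f ⊗ g) n k = Σ≤ n (λ i → Σ≤ k (λ j → f i j * g (n ℕ.∸ i) (k ℕ.∸ j)))

_^ₛ_ : FPS → ℕ → FPS
f ^ₛ zero  = 𝟙
f ^ₛ suc m = f ⊗ (f ^ₛ m)

_·_ : ℚ → FPS → FPS
(c · f) n k = c * f n k

-- Composition with series in one variable, for g with zero z-constant
-- term (g(0,u) = 0), so that g^m has z-order ≥ m and the sum for the
-- coefficient of z^n is finite (only m ≤ n contribute).
-- exp(g) = Σ_m g^m / m!
expₛ : FPS → FPS
expₛ g n k = Σ≤ n (λ m → ((+ 1) / (m !)) {{m !≢0}} * (g ^ₛ m) n k)

neglog1m : FPS → FPS
neglog1m g n k = Σ≤ n (λ m → term m)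
  where
  term : ℕ → ℚ
  term zero    = 0ℚ
  term (suc m) = ((+ 1) / suc m) * (g ^ₛ suc m) n k

geom : FPS → FPS
geom g n k = Σ≤ n (λ m → (g ^ₛ m) n k)

LHS : FPS
LHS zero    k = 0ℚ
LHS (suc m) k = ((+ T k (suc m)) / (suc m !)) {{suc m !≢0}}

RHS : FPS
RHS = z ⊗ (expₛ (z ⊗ (𝟙 ⊖ u))
          ⊗ (((𝟙 ⊕ neglog1m (z ⊗ u)) ⊗ (𝟙 ⊖ u)) ⊕ (u ⊗ geom (z ⊗ u))))

{-# OPTIONS --safe #-}
module Submission where

-- α is read as the word α(0) … α(n-1) on ℤ/n, and H(αβ, βα) counts the letters not
-- followed, cyclically, by their successor. Build the word letter by letter: after p, with a
-- set R of letters left, the sum of u^(number of breaks) over the words that use up R is a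
-- series D d t that depends only on t = #{x ∈ R : x-1 ∈ R ∪ {p}} and d = |R| - t.
-- Fixing the first letter s, the closing pair (last, s) contributes u + (1-u)[last = s-1], and
-- a word that ends in s-1 is a word on one letter fewer that closes at s-1. Hence
-- C_{n+1} = u D 0 n + (1-u) C_n and Σ_k T(k,n) u^k = n C_n. On the analytic side n! times the
-- z^n-coefficients of e^{z(1-u)}/(1-zu) and e^{z(1-u)}(1 - log(1-zu)) are D 0 n and C_n; the
-- second product satisfies the recursion because of the product rule for d/dz.

open import Defs
open import Algebra.Bundles using (CommutativeMonoid; CommutativeRing)
import Algebra.Properties.CommutativeMonoid.Sum as Sum
import Algebra.Properties.Semiring.Sum as SemiringSum
open import Data.Bool using (Bool; true; false; if_then_else_; _∧_; not)
open import Data.Fin using (Fin; zero; suc; toℕ; fromℕ; inject₁)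
open import Data.Fin.Properties using (_≟_; toℕ-injective; toℕ-fromℕ<; toℕ-fromℕ; toℕ-inject₁; toℕ<n; suc-injective)
import Data.Integer as ℤ
import Data.Integer.Properties as ℤ
open import Data.Integer.Solver using () renaming (module +-*-Solver to ℤ-Solver)
open import Data.List as List using (List; []; _∷_; _++_)
open import Data.Nat as ℕ using (ℕ; zero; suc; NonZero; _!; z≤n; s≤s)
open import Data.Nat.DivMod using (_%_; m<n⇒m%n≡m; n%n≡0; m%n<n)
import Data.Nat.Properties as ℕ
open import Data.Nat.Properties using (_!≢0)
open import Data.Product using (_×_; _,_; ∃; proj₁; proj₂)
open import Data.Rational using (ℚ; 0ℚ; 1ℚ; _+_; _*_; -_; _/_)
open import Data.Rational.Properties hiding (_≟_)
open import Data.Rational.Solver using (module +-*-Solver)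
open import Data.Rational.Unnormalised as ℚᵘ using (mkℚᵘ; *≡*)
import Data.Rational.Unnormalised.Properties as ℚᵘ
open import Data.Sum using (_⊎_; inj₁; inj₂)
open import Data.Vec using (Vec; []; _∷_; lookup; _∷ʳ_)
open import Relation.Binary.PropositionalEquality
open import Relation.Nullary using (does; yes; no; contradiction)
open import Relation.Nullary.Decidable using (dec-true; dec-false; ¬?)
open import Relation.Unary using (Decidable)
open +-*-Solver using (solve; _:=_; _:+_; _:*_; :-_; con)
open ≡-Reasoning

-- The recursion defining `D` glues letters. If x could follow x-1, the weight 1 of that succession
-- is u + (1-u): the u-part treats x as a letter that always makes a break, which gives
-- `D (suc d) t`, and the (1-u)-part fuses x to x-1, which leaves one letter fewer, `D d t`. Words
-- and the exponential series instead obey a recursion on one letter at a time, and `D-rec`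
-- reconciles the two. Its correction `ρ` is nonzero only for d = 0. It never enters the count of
-- words, because a nonempty set of remaining letters has a letter whose predecessor is missing; on
-- the analytic side it is exactly the exponential series. When a word is shortened because it ends
-- in s-1, its closing letter moves away from its first letter. The induction therefore runs over
-- open cyclic intervals with independent ends p and c, and the whole circle is the case p = c. The
-- factor n in n C_n is a derivative: the right-hand side of the theorem is z d/dz of e^{z(1-u)} (1
-- - log(1 - zu)).

ι : ℕ → ℚ
ι zero    = 0ℚ
ι (suc n) = 1ℚ + ι n

ι-+ : ∀ m n → ι (m ℕ.+ n) ≡ ι m + ι n
ι-+ zero    n = sym (+-identityˡ (ι n))
ι-+ (suc m) n = trans (cong (1ℚ +_) (ι-+ m n)) (sym (+-assoc 1ℚ (ι m) (ι n)))

ι-* : ∀ m n → ι (m ℕ.* n) ≡ ι m * ι n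
ι-* zero    n = sym (*-zeroˡ (ι n))
ι-* (suc m) n = begin
  ι (n ℕ.+ m ℕ.* n)   ≡⟨ ι-+ n (m ℕ.* n) ⟩
  ι n + ι (m ℕ.* n)   ≡⟨ cong (ι n +_) (ι-* m n) ⟩
  ι n + ι m * ι n     ≡⟨ solve 2 (λ a b → b :+ a :* b := (con 1ℚ :+ a) :* b) refl (ι m) (ι n) ⟩
  (1ℚ + ι m) * ι n    ∎

/-+ : ∀ a b d .{{_ : NonZero d}} → (ℤ.+ (a ℕ.+ b)) / d ≡ (ℤ.+ a) / d + (ℤ.+ b) / d
/-+ a b (suc d) = toℚᵘ-injective
  (ℚᵘ.≃-trans (toℚᵘ-fromℚᵘ (mkℚᵘ (ℤ.+ (a ℕ.+ b)) d))
  (ℚᵘ.≃-trans (*≡* eq)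
  (ℚᵘ.≃-sym (ℚᵘ.≃-trans (toℚᵘ-homo-+ ((ℤ.+ a) / suc d) ((ℤ.+ b) / suc d))
    (ℚᵘ.+-cong (toℚᵘ-fromℚᵘ (mkℚᵘ (ℤ.+ a) d)) (toℚᵘ-fromℚᵘ (mkℚᵘ (ℤ.+ b) d)))))))
  where
  eq : ℤ.+ (a ℕ.+ b) ℤ.* (ℤ.+ suc d ℤ.* ℤ.+ suc d) ≡ (ℤ.+ a ℤ.* ℤ.+ suc d ℤ.+ ℤ.+ b ℤ.* ℤ.+ suc d) ℤ.* ℤ.+ suc d
  eq = ℤ-Solver.solve 3 (λ x y e → (x ℤ-Solver.:+ y) ℤ-Solver.:* (e ℤ-Solver.:* e) ℤ-Solver.:=
                                   (x ℤ-Solver.:* e ℤ-Solver.:+ y ℤ-Solver.:* e) ℤ-Solver.:* e)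
         refl (ℤ.+ a) (ℤ.+ b) (ℤ.+ suc d)

/-ι : ∀ a d .{{_ : NonZero d}} → (ℤ.+ a) / d ≡ ι a * ((ℤ.+ 1) / d)
/-ι zero    d = trans (0/n≡0 d) (sym (*-zeroˡ ((ℤ.+ 1) / d)))
/-ι (suc a) d = begin
  (ℤ.+ suc a) / d                      ≡⟨ /-+ 1 a d ⟩
  (ℤ.+ 1) / d + (ℤ.+ a) / d              ≡⟨ cong ((ℤ.+ 1) / d +_) (/-ι a d) ⟩
  (ℤ.+ 1) / d + ι a * ((ℤ.+ 1) / d)      ≡⟨ solve 2 (λ x y → x :+ y :* x := (con 1ℚ :+ y) :* x) refl ((ℤ.+ 1) / d) (ι a) ⟩
  (1ℚ + ι a) * ((ℤ.+ 1) / d)           ∎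

ι-inverse : ∀ d .{{_ : NonZero d}} → ι d * ((ℤ.+ 1) / d) ≡ 1ℚ
ι-inverse (suc d) = trans (sym (/-ι (suc d) (suc d)))
  (fromℚᵘ-cong {mkℚᵘ (ℤ.+ suc d) d} {mkℚᵘ (ℤ.+ 1) 0} (*≡* (ℤ.*-comm (ℤ.+ suc d) (ℤ.+ 1))))

-- Power series in u; sh is multiplication by u and Q multiplication by 1 - u.
Series : Set
Series = ℕ → ℚ

δ : Series
δ zero    = 1ℚ
δ (suc _) = 0ℚ

sh : Series → Series
sh f zero    = 0ℚ
sh f (suc k) = f k

Q : Series → Series
Q f k = f k + - sh f k

infix 4 _≗ₛ_
_≗ₛ_ : Series → Series → Set
f ≗ₛ g = ∀ k → f k ≡ g k

record Linear (op : Series → Series) : Set where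
  field
    op-cong : ∀ {f g} → f ≗ₛ g → op f ≗ₛ op g
    op-+    : ∀ f g → op (λ k → f k + g k) ≗ₛ (λ k → op f k + op g k)
    op-*    : ∀ c f → op (λ k → c * f k) ≗ₛ (λ k → c * op f k)
open Linear public

sh-linear : Linear sh
sh-linear .op-cong e zero    = refl
sh-linear .op-cong e (suc k) = e k
sh-linear .op-+ f g zero    = refl
sh-linear .op-+ f g (suc k) = refl
sh-linear .op-* c f zero    = sym (*-zeroʳ c)
sh-linear .op-* c f (suc k) = refl

Q-linear : Linear Q
Q-linear .op-cong e k = cong₂ (λ x y → x + - y) (e k) (op-cong sh-linear e k)
Q-linear .op-+ f g k = begin
  f k + g k + - sh (λ k → f k + g k) k     ≡⟨ cong (λ x → f k + g k + - x) (op-+ sh-linear f g k) ⟩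
  f k + g k + - (sh f k + sh g k)          ≡⟨ solve 4 (λ a b c d → a :+ b :+ :- (c :+ d) := a :+ :- c :+ (b :+ :- d)) refl (f k) (g k) (sh f k) (sh g k) ⟩
  Q f k + Q g k                            ∎
Q-linear .op-* c f k = begin
  c * f k + - sh (λ k → c * f k) k   ≡⟨ cong (λ x → c * f k + - x) (op-* sh-linear c f k) ⟩
  c * f k + - (c * sh f k)           ≡⟨ solve 3 (λ a b c → a :* b :+ :- (a :* c) := a :* (b :+ :- c)) refl c (f k) (sh f k) ⟩
  c * Q f k                          ∎

Q-sh : ∀ f → Q (sh f) ≗ₛ sh (Q f)
Q-sh f zero    = refl
Q-sh f (suc k) = refl

iter : (Series → Series) → ℕ → Series → Series
iter op zero    f = f
iter op (suc n) f = op (iter op n f)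

iter-linear : ∀ {op} → Linear op → ∀ n → Linear (iter op n)
iter-linear L zero .op-cong e = e
iter-linear L zero .op-+ f g k = refl
iter-linear L zero .op-* c f k = refl
iter-linear L (suc n) .op-cong e = op-cong L (op-cong (iter-linear L n) e)
iter-linear {op} L (suc n) .op-+ f g k = trans (op-cong L (op-+ (iter-linear L n) f g) k) (op-+ L (iter op n f) (iter op n g) k)
iter-linear {op} L (suc n) .op-* c f k = trans (op-cong L (op-* (iter-linear L n) c f) k) (op-* L c (iter op n f) k)

-- In closed form, D d t = Σ_j (t choose j) (1-u)^j u^{d+t-j} (d+t-j)!, by inclusion–exclusion
-- over the set of t letters that could be preceded by their predecessor.
D₀ : ℕ → Series
D₀ zero    = δ
D₀ (suc d) = λ k → ι (suc d) * sh (D₀ d) k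

D : ℕ → ℕ → Series
D d zero    = D₀ d
D d (suc t) = λ k → D (suc d) t k + Q (D d t) k

-- The defect of the factorial recursion. In the closed form of `D d t`, the factorial (d+t-j)! is
-- (d + (t-j)) (d+t-j-1)! except for 0!, which occurs only for d = 0 and j = t; that term is
-- (1-u)^t.
ρ : ℕ → ℕ → Series
ρ zero    t = iter Q t δ
ρ (suc _) t = λ _ → 0ℚ

ρ-suc : ∀ d t k → ρ (suc d) t k + Q (ρ d t) k ≡ ρ d (suc t) k
ρ-suc zero    t k = +-identityˡ _
ρ-suc (suc d) t zero    = refl
ρ-suc (suc d) t (suc k) = refl

-- The contribution to D d t of all first letters, each counted as a break.
first-letter : ℕ → ℕ → Series
first-letter d t k = ι t * sh (D d (t ℕ.∸ 1)) k + ι d * sh (D (d ℕ.∸ 1) t) k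

-- Induction on t: the formulas for (d+1, t) and, under `Q`, for (d, t) are added, and the defining
-- recursion of `D` reassembles the sums one level down. The extra `sh (D d t)` coming from d + 1
-- raises the factor t to t + 1.
D-rec : ∀ d t k → D d t k ≡ first-letter d t k + ρ d t k
D-rec zero    zero k = solve 3 (λ x a b → x := (con 0ℚ :* a :+ con 0ℚ :* b) :+ x) refl (δ k) (sh δ k) (sh δ k)
D-rec (suc d) zero k = solve 3 (λ x a b → x :* a := (con 0ℚ :* b :+ x :* a) :+ con 0ℚ) refl (ι (suc d)) (sh (D d zero) k) (sh (D (suc d) zero) k)
D-rec d (suc t) k = begin
  D (suc d) t k + Q (D d t) k
    ≡⟨ cong₂ _+_ (D-rec (suc d) t k) (trans (op-cong Q-linear (D-rec d t) k) expand) ⟩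
  ι t * sh (D (suc d) (t ℕ.∸ 1)) k + (1ℚ + ι d) * sh (D d t) k + ρ (suc d) t k
    + (ι t * Q (sh (D d (t ℕ.∸ 1))) k + ι d * Q (sh (D (d ℕ.∸ 1) t)) k + Q (ρ d t) k)
    ≡⟨ solve 8 (λ τ a e b r c c′ r′ →
         τ :* a :+ (con 1ℚ :+ e) :* b :+ r :+ (τ :* c :+ e :* c′ :+ r′)
         := τ :* (a :+ c) :+ b :+ e :* (b :+ c′) :+ (r :+ r′))
         refl (ι t) (sh (D (suc d) (t ℕ.∸ 1)) k) (ι d) (sh (D d t) k) (ρ (suc d) t k)
         (Q (sh (D d (t ℕ.∸ 1))) k) (Q (sh (D (d ℕ.∸ 1) t)) k) (Q (ρ d t) k) ⟩
  ι t * (sh (D (suc d) (t ℕ.∸ 1)) k + Q (sh (D d (t ℕ.∸ 1))) k) + sh (D d t) k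
    + ι d * (sh (D d t) k + Q (sh (D (d ℕ.∸ 1) t)) k) + (ρ (suc d) t k + Q (ρ d t) k)
    ≡⟨ cong₂ _+_ (cong₂ _+_ (cong (_+ sh (D d t) k) (t-part d t)) (d-part d t)) (ρ-suc d t k) ⟩
  ι t * sh (D d t) k + sh (D d t) k + ι d * sh (D (d ℕ.∸ 1) (suc t)) k + ρ d (suc t) k
    ≡⟨ solve 4 (λ τ a b c → τ :* a :+ a :+ b :+ c := (con 1ℚ :+ τ) :* a :+ b :+ c) refl
         (ι t) (sh (D d t) k) (ι d * sh (D (d ℕ.∸ 1) (suc t)) k) (ρ d (suc t) k) ⟩
  (1ℚ + ι t) * sh (D d t) k + ι d * sh (D (d ℕ.∸ 1) (suc t)) k + ρ d (suc t) k ∎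
  where
  merge : ∀ d t → sh (D (suc d) t) k + Q (sh (D d t)) k ≡ sh (D d (suc t)) k
  merge d t = trans (cong (sh (D (suc d) t) k +_) (Q-sh (D d t) k))
                    (sym (op-+ sh-linear (D (suc d) t) (Q (D d t)) k))
  -- At 0 the truncated `t ∸ 1` or `d ∸ 1` names a meaningless series, but its coefficient `ι 0`
  -- annihilates it.
  zero-* : ∀ x y → 0ℚ * x ≡ 0ℚ * y
  zero-* x y = trans (*-zeroˡ x) (sym (*-zeroˡ y))
  t-part : ∀ d t → ι t * (sh (D (suc d) (t ℕ.∸ 1)) k + Q (sh (D d (t ℕ.∸ 1))) k) ≡ ι t * sh (D d t) k
  t-part d zero    = zero-* (sh (D (suc d) 0) k + Q (sh (D d 0)) k) (sh (D d 0) k)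
  t-part d (suc t) = cong (ι (suc t) *_) (merge d t)
  d-part : ∀ d t → ι d * (sh (D d t) k + Q (sh (D (d ℕ.∸ 1) t)) k) ≡ ι d * sh (D (d ℕ.∸ 1) (suc t)) k
  d-part zero    t = zero-* (sh (D 0 t) k + Q (sh (D 0 t)) k) (sh (D 0 (suc t)) k)
  d-part (suc d) t = cong (ι (suc d) *_) (merge d t)
  expand : Q (λ k → first-letter d t k + ρ d t k) k
         ≡ ι t * Q (sh (D d (t ℕ.∸ 1))) k + ι d * Q (sh (D (d ℕ.∸ 1) t)) k + Q (ρ d t) k
  expand = trans (op-+ Q-linear (first-letter d t) (ρ d t) k) (cong (_+ Q (ρ d t) k)
    (trans (op-+ Q-linear (λ k → ι t * f k) (λ k → ι d * g k) k)
           (cong₂ _+_ (op-* Q-linear (ι t) f k) (op-* Q-linear (ι d) g k))))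
    where
    f = sh (D d (t ℕ.∸ 1))
    g = sh (D (d ℕ.∸ 1) t)

C : ℕ → Series
C zero    = δ
C (suc n) = λ k → sh (D 0 n) k + Q (C n) k

-- Finite sums over the alphabet and cardinalities of Boolean subsets

module _ {a ℓ} (M : CommutativeMonoid a ℓ) where
  open CommutativeMonoid M renaming (_∙_ to _⊹_; ε to 0#; refl to ≈-refl; sym to ≈-sym; trans to ≈-trans)
  open Sum M

  -- Stated over a monoid because it isolates one letter both in cardinalities over ℕ and in sums of
  -- weights over ℚ.
  sum-single : ∀ {n} (c : Fin n) (f : Fin n → Carrier) →
               sum (λ q → if does (q ≟ c) then f q else 0#) ≈ f c
  sum-single {suc n} zero    f = ≈-trans (∙-congˡ (sum-replicate-zero n)) (identityʳ (f zero))
  sum-single {suc n} (suc c) f = ≈-trans (identityˡ _) (sum-single c (λ q → f (suc q)))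

open SemiringSum (CommutativeRing.semiring +-*-commutativeRing)
  using (sum; sum-cong-≗; sum-replicate-zero; ∑-distrib-+)
open Sum ℕ.+-0-commutativeMonoid
  using () renaming (sum to sumℕ; sum-cong-≗ to sumℕ-cong; ∑-distrib-+ to sumℕ-+)

b→ℕ : Bool → ℕ
b→ℕ b = if b then 1 else 0

count : ∀ {n} → (Fin n → Bool) → ℕ
count f = sumℕ (λ x → b→ℕ (f x))

infix 5 _when_
_when_ : ℚ → Bool → ℚ
x when b = if b then x else 0ℚ

sum-when-const : ∀ {n} x (f : Fin n → Bool) → sum (λ q → x when f q) ≡ ι (count f) * x
sum-when-const {zero}  x f = sym (*-zeroˡ x)
sum-when-const {suc n} x f with f zero
... | false = trans (+-identityˡ _) (sum-when-const x (λ q → f (suc q)))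
... | true  = trans (cong (x +_) (sum-when-const x (λ q → f (suc q))))
  (solve 2 (λ a b → a :+ b :* a := (con 1ℚ :+ b) :* a) refl x (ι (count (λ q → f (suc q)))))

count-empty : ∀ {n} (f : Fin n → Bool) → (∀ x → f x ≡ false) → count f ≡ 0
count-empty {zero}  f e = refl
count-empty {suc n} f e rewrite e zero = count-empty (λ q → f (suc q)) (λ q → e (suc q))

count≡0 : ∀ {n} (f : Fin n → Bool) → count f ≡ 0 → ∀ x → f x ≡ false
count≡0 f e zero with f zero
... | false = refl
count≡0 f e (suc x) = count≡0 (λ q → f (suc q)) (ℕ.m+n≡0⇒n≡0 (b→ℕ (f zero)) e) x

count≥ : ∀ {n} (f : Fin n → Bool) x → b→ℕ (f x) ℕ.≤ count f
count≥ f zero    = ℕ.m≤m+n _ _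
count≥ f (suc x) = ℕ.≤-trans (count≥ (λ q → f (suc q)) x) (ℕ.m≤n+m _ (b→ℕ (f zero)))

op-zero : ∀ {op} → Linear op → ∀ {f} → f ≗ₛ (λ _ → 0ℚ) → op f ≗ₛ (λ _ → 0ℚ)
op-zero {op} L {f} e k = trans (op-cong L {g = λ _ → 0ℚ * 0ℚ} e k)
  (trans (op-* L 0ℚ (λ _ → 0ℚ) k) (*-zeroˡ (op (λ _ → 0ℚ) k)))

nonempty : ∀ {m r} (f : Fin m → Bool) → count f ≡ suc r → ∃ λ x → f x ≡ true
nonempty {suc m} f e with f zero in f0
... | true  = zero , f0
... | false with nonempty (λ q → f (suc q)) e
... | x , fx = suc x , fx

sum-linear : ∀ {n op} → Linear op → (f : Fin n → Series) →
             op (λ k → sum (λ q → f q k)) ≗ₛ (λ k → sum (λ q → op (f q) k))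
sum-linear {zero}       L f k = op-zero L (λ _ → refl) k
sum-linear {suc n} {op} L f k = trans (op-+ L (f zero) (λ k → sum (λ q → f (suc q) k)) k)
  (cong (op (f zero) k +_) (sum-linear L (λ q → f (suc q)) k))

when-linear : ∀ {op} → Linear op → ∀ b f → op (λ k → f k when b) ≗ₛ (λ k → op f k when b)
when-linear L true  f k = refl
when-linear L false f k = op-zero L (λ _ → refl) k

-- Weighted words over a cyclically ordered alphabet

module Words {n} (next prev : Fin n → Fin n)
  (prev-next : ∀ x → prev (next x) ≡ x) (next-prev : ∀ x → next (prev x) ≡ x)
  -- The hypothesis that `next` is a single cycle, as an induction principle: a nonempty subset
  -- closed under `next` is the whole alphabet.
  (reach : ∀ (P : Fin n → Set) → (∀ x → P x → P (next x)) → ∀ p → P p → ∀ x → P x) where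

  FinSet : Set
  FinSet = Fin n → Bool

  _∖_ : FinSet → Fin n → FinSet
  (R ∖ q) x = R x ∧ not (does (x ≟ q))

  ∖-self : ∀ R q → (R ∖ q) q ≡ false
  ∖-self R q rewrite dec-true (q ≟ q) refl with R q
  ... | true  = refl
  ... | false = refl

  ∖-other : ∀ R q {x} → x ≢ q → (R ∖ q) x ≡ R x
  ∖-other R q {x} x≢q rewrite dec-false (x ≟ q) x≢q with R x
  ... | true  = refl
  ... | false = refl

  -- The preceding letter p is deliberately ignored here, so that the effect of removing a letter
  -- can be tracked on the set alone. The letter `next p` is reclassified only in `F-δ`.
  joined unjoined : FinSet → FinSet
  joined   R x = R x ∧ R (prev x)
  unjoined R x = R x ∧ not (R (prev x))

  -- The weight of the pair (p, q), 1 for a succession and u for a break, written as u +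
  -- (1-u)[q = next p]. In this form a sum over q treats all letters as breaks and has one
  -- correction term, at `next p`.
  step : Fin n → Fin n → Series → Series
  step p q f k = sh f k + (Q f k when does (q ≟ next p))

  step-linear : ∀ p q → Linear (step p q)
  step-linear p q with does (q ≟ next p)
  ... | true  = record
    { op-cong = λ e k → cong₂ _+_ (op-cong sh-linear e k) (op-cong Q-linear e k)
    ; op-+ = λ f g k → trans (cong₂ _+_ (op-+ sh-linear f g k) (op-+ Q-linear f g k))
        (solve 4 (λ a b c d → (a :+ b) :+ (c :+ d) := (a :+ c) :+ (b :+ d)) refl (sh f k) (sh g k) (Q f k) (Q g k))
    ; op-* = λ c f k → trans (cong₂ _+_ (op-* sh-linear c f k) (op-* Q-linear c f k))
        (sym (*-distribˡ-+ c (sh f k) (Q f k)))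
    }
  ... | false = record
    { op-cong = λ e k → cong (_+ 0ℚ) (op-cong sh-linear e k)
    ; op-+ = λ f g k → trans (cong (_+ 0ℚ) (op-+ sh-linear f g k))
        (solve 2 (λ a b → (a :+ b) :+ con 0ℚ := (a :+ con 0ℚ) :+ (b :+ con 0ℚ)) refl (sh f k) (sh g k))
    ; op-* = λ c f k → trans (cong (_+ 0ℚ) (op-* sh-linear c f k))
        (solve 2 (λ a b → a :* b :+ con 0ℚ := a :* (b :+ con 0ℚ)) refl c (sh f k))
    }

  -- The sum over all words with r distinct letters from R, written after the letter p, of
  -- u^(number of breaks) times h of the last letter.
  F : (Fin n → Series) → ℕ → FinSet → Fin n → Series
  F h zero    R p = h p
  F h (suc r) R p = λ k → sum (λ q → step p q (F h r (R ∖ q) q) k when R q)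

  F-cong : ∀ {h h′ R R′} → (∀ q → h q ≗ₛ h′ q) → (∀ x → R x ≡ R′ x) →
           ∀ r p → F h r R p ≗ₛ F h′ r R′ p
  F-cong eh eR zero    p k = eh p k
  F-cong {R = R} {R′} eh eR (suc r) p k = sum-cong-≗ (λ q → cong₂ _when_
    (op-cong (step-linear p q) (F-cong eh (λ x → cong (_∧ not (does (x ≟ q))) (eR x)) r q) k) (eR q))

  F-+ : ∀ h g r R p → F (λ q k → h q k + g q k) r R p ≗ₛ (λ k → F h r R p k + F g r R p k)
  F-+ h g zero    R p k = refl
  F-+ h g (suc r) R p k = trans (sum-cong-≗ term) (∑-distrib-+ {n} _ _)
    where
    when-+ : ∀ x y b → (x + y when b) ≡ (x when b) + (y when b)
    when-+ x y true  = refl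
    when-+ x y false = refl
    term : ∀ q → (step p q (F (λ q k → h q k + g q k) r (R ∖ q) q) k when R q)
         ≡ (step p q (F h r (R ∖ q) q) k when R q) + (step p q (F g r (R ∖ q) q) k when R q)
    term q = trans (cong (_when R q) (trans (op-cong (step-linear p q) (F-+ h g r (R ∖ q) q) k)
                                            (op-+ (step-linear p q) (F h r (R ∖ q) q) (F g r (R ∖ q) q) k)))
                   (when-+ (step p q (F h r (R ∖ q) q) k) (step p q (F g r (R ∖ q) q) k) (R q))

  -- `F` is assembled from sums, `sh` and `Q`, so an operator that commutes with these can be pulled
  -- out from the last letter to the whole sum.
  F-op : ∀ {op} → Linear op → (∀ f → op (sh f) ≗ₛ sh (op f)) → (∀ f → op (Q f) ≗ₛ Q (op f)) →
         ∀ h r R p → F (λ q → op (h q)) r R p ≗ₛ op (F h r R p)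
  F-op L op-sh op-Q h zero    R p k = refl
  F-op {op} L op-sh op-Q h (suc r) R p k = sym (trans
    (sum-linear L (λ q k → step p q (F h r (R ∖ q) q) k when R q) k)
    (sum-cong-≗ (λ q → trans (when-linear L (R q) (step p q (F h r (R ∖ q) q)) k)
      (cong (_when R q) (trans (op-step q (F h r (R ∖ q) q))
        (op-cong (step-linear p q) (λ j → sym (F-op L op-sh op-Q h r (R ∖ q) q j)) k))))))
    where
    op-step : ∀ q f → op (step p q f) k ≡ step p q (op f) k
    op-step q f = trans (op-+ L (sh f) (λ k → Q f k when does (q ≟ next p)) k)
      (cong₂ _+_ (op-sh f k) (trans (when-linear L (does (q ≟ next p)) (Q f) k)
                                    (cong (_when does (q ≟ next p)) (op-Q f k))))

  -- If no letter were unjoined, the complement of `R` would be closed under `next`; since it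
  -- contains `p`, it would be everything, contradicting x ∈ R.
  unjoined-exists : ∀ R p x → R p ≡ false → R x ≡ true → count (unjoined R) ≢ 0
  unjoined-exists R p x Rp Rx none with trans (sym Rx) (reach (λ y → R y ≡ false) closed p Rp x)
    where
    closed : ∀ y → R y ≡ false → R (next y) ≡ false
    closed y Ry with count≡0 (unjoined R) none (next y)
    ... | e rewrite prev-next y | Ry with R (next y)
    ... | false = refl
  ... | ()

  split : ∀ R → count R ≡ count (joined R) ℕ.+ count (unjoined R)
  split R = trans (sumℕ-cong pointwise) (sumℕ-+ {n} _ _)
    where
    pointwise : ∀ x → b→ℕ (R x) ≡ b→ℕ (joined R x) ℕ.+ b→ℕ (unjoined R x)
    pointwise x with R x | R (prev x)
    ... | true  | true  = refl
    ... | true  | false = refl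
    ... | false | _     = refl

  count-single : ∀ c (f : FinSet) → sumℕ (λ x → if does (x ≟ c) then b→ℕ (f x) else 0) ≡ b→ℕ (f c)
  count-single c f = sum-single ℕ.+-0-commutativeMonoid c (λ x → b→ℕ (f x))

  count-remove : ∀ R q → R q ≡ true → count R ≡ suc (count (R ∖ q))
  count-remove R q Rq = trans (sumℕ-cong pointwise) (trans (sumℕ-+ {n} _ _)
    (cong (ℕ._+ count (R ∖ q)) (trans (count-single q R) (cong b→ℕ Rq))))
    where
    pointwise : ∀ x → b→ℕ (R x) ≡ (if does (x ≟ q) then b→ℕ (R x) else 0) ℕ.+ b→ℕ ((R ∖ q) x)
    pointwise x with does (x ≟ q) | R x
    ... | true  | true  = refl
    ... | true  | false = refl
    ... | false | true  = refl
    ... | false | false = refl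

  -- Removing q affects only two letters: q itself disappears, and `next q` loses its predecessor.
  -- Testing `next q` in the smaller set gives the right value also when `next q` is q.
  joined-remove : ∀ R q → R q ≡ true →
    count (joined R) ≡ b→ℕ (R (prev q)) ℕ.+ (count (joined (R ∖ q)) ℕ.+ b→ℕ ((R ∖ q) (next q)))
  joined-remove R q Rq = trans (sumℕ-cong pointwise) (trans (sumℕ-+ {n} _ _)
    (cong₂ ℕ._+_ (count-single q (λ x → R (prev x))) (trans (sumℕ-+ {n} _ _)
      (cong (count (joined (R ∖ q)) ℕ.+_) (count-single (next q) (R ∖ q))))))
    where
    pointwise : ∀ x → b→ℕ (joined R x) ≡ (if does (x ≟ q) then b→ℕ (R (prev x)) else 0)
      ℕ.+ (b→ℕ (joined (R ∖ q) x) ℕ.+ (if does (x ≟ next q) then b→ℕ ((R ∖ q) x) else 0))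
    pointwise x with x ≟ q | x ≟ next q
    pointwise x | yes refl | no _ rewrite Rq = sym (ℕ.+-identityʳ _)
    pointwise x | yes refl | yes _ rewrite Rq = sym (ℕ.+-identityʳ _)
    pointwise x | no x≢q | yes refl rewrite prev-next q | dec-true (q ≟ q) refl | Rq with R (next q)
    ... | true  = refl
    ... | false = refl
    pointwise x | no x≢q | no x≢nq
      rewrite dec-false (prev x ≟ q) (λ e → x≢nq (trans (sym (next-prev x)) (cong next e)))
      with R x | R (prev x)
    ... | true  | true  = refl
    ... | true  | false = refl
    ... | false | _     = refl

  -- The same two letters matter: q leaves the unjoined set if it was there, and `next q` enters it
  -- if it remains. It is kept as a balance of sums so that no truncated subtraction arises.
  unjoined-remove : ∀ R q → R q ≡ true →
    count (unjoined R) ℕ.+ b→ℕ ((R ∖ q) (next q)) ≡ b→ℕ (not (R (prev q))) ℕ.+ count (unjoined (R ∖ q))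
  unjoined-remove R q Rq = begin
    count (unjoined R) ℕ.+ b→ℕ ((R ∖ q) (next q))
      ≡⟨ cong (count (unjoined R) ℕ.+_) (sym (count-single (next q) (R ∖ q))) ⟩
    count (unjoined R) ℕ.+ sumℕ (λ x → if does (x ≟ next q) then b→ℕ ((R ∖ q) x) else 0)
      ≡⟨ sym (sumℕ-+ {n} _ _) ⟩
    sumℕ (λ x → b→ℕ (unjoined R x) ℕ.+ (if does (x ≟ next q) then b→ℕ ((R ∖ q) x) else 0))
      ≡⟨ sumℕ-cong pointwise ⟩
    sumℕ (λ x → (if does (x ≟ q) then b→ℕ (not (R (prev x))) else 0) ℕ.+ b→ℕ (unjoined (R ∖ q) x))
      ≡⟨ sumℕ-+ {n} _ _ ⟩
    sumℕ (λ x → if does (x ≟ q) then b→ℕ (not (R (prev x))) else 0) ℕ.+ count (unjoined (R ∖ q))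
      ≡⟨ cong (ℕ._+ count (unjoined (R ∖ q))) (count-single q (λ x → not (R (prev x)))) ⟩
    b→ℕ (not (R (prev q))) ℕ.+ count (unjoined (R ∖ q)) ∎
    where
    pointwise : ∀ x → b→ℕ (unjoined R x) ℕ.+ (if does (x ≟ next q) then b→ℕ ((R ∖ q) x) else 0)
      ≡ (if does (x ≟ q) then b→ℕ (not (R (prev x))) else 0) ℕ.+ b→ℕ (unjoined (R ∖ q) x)
    pointwise x with x ≟ q | x ≟ next q
    pointwise x | yes refl | no _  rewrite Rq = refl
    pointwise x | yes refl | yes _ rewrite Rq = refl
    pointwise x | no x≢q | yes refl rewrite prev-next q | dec-true (q ≟ q) refl | Rq with R (next q)
    ... | true  = refl
    ... | false = refl
    pointwise x | no x≢q | no x≢nq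
      rewrite dec-false (prev x ≟ q) (λ e → x≢nq (trans (sym (next-prev x)) (cong next e)))
      with R x | R (prev x)
    ... | true  | true  = refl
    ... | true  | false = refl
    ... | false | _     = refl

  -- As p is not in `R`, the letter `next p`, if it remains, is unjoined although it could follow p.
  -- So it is moved from the unjoined count to the joined one, which yields d and t.
  F-δ : ∀ r R p → R p ≡ false → count R ≡ r → ∀ d t →
        count (unjoined R) ≡ b→ℕ (R (next p)) ℕ.+ d → count (joined R) ℕ.+ b→ℕ (R (next p)) ≡ t →
        F (λ _ → δ) r R p ≗ₛ D d t
  F-δ zero R p Rp cR d t ed et k rewrite count≡0 R cR (next p)
    with trans (sym ed) (count-empty (unjoined R) none₁) | trans (sym et) (trans (ℕ.+-identityʳ _) (count-empty (joined R) none₂))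
    where
    none₁ : ∀ x → unjoined R x ≡ false
    none₁ x rewrite count≡0 R cR x = refl
    none₂ : ∀ x → joined R x ≡ false
    none₂ x rewrite count≡0 R cR x = refl
  ... | refl | refl = refl
  F-δ (suc r) R p Rp cR d t ed et k = begin
    sum (λ q → step p q (F (λ _ → δ) r (R ∖ q) q) k when R q)
      ≡⟨ sum-cong-≗ term ⟩
    sum (λ q → (joined-term q + unjoined-term q) + (if does (q ≟ next p) then succession q else 0ℚ))
      ≡⟨ trans (∑-distrib-+ {n} _ _) (cong₂ _+_ (∑-distrib-+ {n} _ _) (sum-single +-0-commutativeMonoid (next p) succession)) ⟩
    sum joined-term + sum unjoined-term + succession (next p)
      ≡⟨ cong (_+ succession (next p)) (cong₂ _+_ (sum-when-const (sh (V true) k) (joined R)) (sum-when-const (sh (V false) k) (unjoined R))) ⟩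
    first-letter d₀ t₀ k + succession (next p)
      -- The predecessor of `next p` is p, which is not in `R`; so writing `next p` first uses up an
      -- unjoined letter, hence `d₀ ∸ 1`.
      ≡⟨ cong (λ b → first-letter d₀ t₀ k + (Q (V b) k when R (next p))) (trans (cong R (prev-next p)) Rp) ⟩
    first-letter d₀ t₀ k + (Q (D (d₀ ℕ.∸ 1) t₀) k when R (next p))
      ≡⟨ finish d₀ refl ed et ⟩
    D d t k ∎
    where
    d₀ = count (unjoined R)
    t₀ = count (joined R)
    V : Bool → Series
    V b = D (d₀ ℕ.∸ b→ℕ (not b)) (t₀ ℕ.∸ b→ℕ b)
    joined-term unjoined-term succession : Fin n → ℚ
    joined-term   q = sh (V true) k when joined R q
    unjoined-term q = sh (V false) k when unjoined R q
    succession    q = Q (V (R (prev q))) k when R q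
    -- This is why only d and t matter. Once q is written, `next q` loses its predecessor in the set
    -- but may follow q, so the two effects cancel; what remains is the loss of q, from the joined
    -- or the unjoined count.
    V-rest : ∀ q → R q ≡ true → F (λ _ → δ) r (R ∖ q) q ≗ₛ V (R (prev q))
    V-rest q Rq = F-δ r (R ∖ q) q (∖-self R q) (ℕ.suc-injective (trans (sym (count-remove R q Rq)) cR)) _ _ eqd eqt
      where
      b = b→ℕ (not (R (prev q)))
      c = b→ℕ ((R ∖ q) (next q))
      b≤ : b ℕ.≤ d₀
      b≤ = subst (λ y → b→ℕ (y ∧ not (R (prev q))) ℕ.≤ d₀) Rq (count≥ (unjoined R) q)
      eqd : count (unjoined (R ∖ q)) ≡ c ℕ.+ (d₀ ℕ.∸ b)
      eqd = begin
        count (unjoined (R ∖ q))             ≡⟨ sym (ℕ.m+n∸m≡n b _) ⟩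
        (b ℕ.+ count (unjoined (R ∖ q))) ℕ.∸ b ≡⟨ cong (ℕ._∸ b) (sym (unjoined-remove R q Rq)) ⟩
        (d₀ ℕ.+ c) ℕ.∸ b                     ≡⟨ cong (ℕ._∸ b) (ℕ.+-comm d₀ c) ⟩
        (c ℕ.+ d₀) ℕ.∸ b                     ≡⟨ ℕ.+-∸-assoc c b≤ ⟩
        c ℕ.+ (d₀ ℕ.∸ b)                     ∎
      eqt : count (joined (R ∖ q)) ℕ.+ c ≡ t₀ ℕ.∸ b→ℕ (R (prev q))
      eqt = trans (sym (ℕ.m+n∸m≡n (b→ℕ (R (prev q))) _)) (cong (ℕ._∸ b→ℕ (R (prev q))) (sym (joined-remove R q Rq)))
    term : ∀ q → (step p q (F (λ _ → δ) r (R ∖ q) q) k when R q)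
         ≡ (joined-term q + unjoined-term q) + (if does (q ≟ next p) then succession q else 0ℚ)
    term q with R q in Rq
    ... | false = sym (trans (+-identityˡ _) (if-same (does (q ≟ next p))))
      where
      if-same : ∀ b → (if b then 0ℚ else 0ℚ) ≡ 0ℚ
      if-same true  = refl
      if-same false = refl
    ... | true  = trans (op-cong (step-linear p q) (V-rest q Rq) k) (cong (_+ (Q (V (R (prev q))) k when does (q ≟ next p))) (by-prev (R (prev q))))
      where
      by-prev : ∀ b → sh (V b) k ≡ (sh (V true) k when b) + (sh (V false) k when not b)
      by-prev true  = sym (+-identityʳ _)
      by-prev false = sym (+-identityˡ _)
    -- A nonempty `R` has an unjoined letter, so d₀ > 0 and `ρ` vanishes. If `next p` is absent,
    -- `D-rec` is the claim. If it is present, `D-rec` turns the first summand into `D (suc d) t₀`,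
    -- and the correction completes the defining recursion of `D d (suc t₀)`.
    finish : ∀ d′ → d₀ ≡ d′ → d₀ ≡ b→ℕ (R (next p)) ℕ.+ d → t₀ ℕ.+ b→ℕ (R (next p)) ≡ t →
             first-letter d′ t₀ k + (Q (D (d′ ℕ.∸ 1) t₀) k when R (next p)) ≡ D d t k
    finish zero e _ _ with nonempty R cR
    ... | x , Rx = contradiction e (unjoined-exists R p x Rp Rx)
    finish (suc d′) e ed′ et′ with R (next p) | trans (sym e) ed′
    ... | false | refl = subst (λ t → first-letter (suc d′) t₀ k + 0ℚ ≡ D (suc d′) t k) (trans (sym (ℕ.+-identityʳ t₀)) et′)
                           (sym (D-rec (suc d′) t₀ k))
    ... | true  | refl = subst (λ t → first-letter (suc d′) t₀ k + Q (D d′ t₀) k ≡ D d′ t k) (trans (ℕ.+-comm 1 t₀) et′)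
                           (cong (_+ Q (D d′ t₀) k) (sym (trans (D-rec (suc d′) t₀ k) (+-identityʳ (first-letter (suc d′) t₀ k)))))

  ending : Fin n → Fin n → Series
  ending e q k = δ k when does (q ≟ e)

  when-zero : ∀ {x} b → x ≡ 0ℚ → (x when b) ≡ 0ℚ
  when-zero true  e = e
  when-zero false e = refl

  sum-zero : ∀ {f : Fin n → ℚ} → (∀ q → f q ≡ 0ℚ) → sum f ≡ 0ℚ
  sum-zero e = trans (sum-cong-≗ e) (sum-replicate-zero n)

  -- The length is `suc r` because the empty word has last letter `p`, which may be `e`.
  F-ending-absent : ∀ e r R p → R e ≡ false → F (ending e) (suc r) R p ≗ₛ (λ _ → 0ℚ)
  F-ending-absent e zero R p Re k = sum-zero term
    where
    term : ∀ q → (step p q (ending e q) k when R q) ≡ 0ℚ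
    term q with q ≟ e
    ... | yes refl rewrite Re = refl
    ... | no _ = when-zero (R q) (op-zero (step-linear p q) (λ _ → refl) k)
  F-ending-absent e (suc r) R p Re k = sum-zero (λ q → when-zero (R q)
    (op-zero (step-linear p q) (F-ending-absent e r (R ∖ q) q (absent q)) k))
    where
    absent : ∀ q → (R ∖ q) e ≡ false
    absent q rewrite Re = refl

  -- The letter `e`, used last, occurs nowhere earlier, so it can be deleted from the set, and the
  -- final step onto `e` becomes the closing step of a word one letter shorter. Words that use `e`
  -- too early contribute 0 by `F-ending-absent`.
  F-ending-last : ∀ e r R p → R e ≡ true → F (ending e) (suc r) R p ≗ₛ F (λ q → step q e δ) r (R ∖ e) p
  F-ending-last e zero R p Re k = trans (sum-cong-≗ term)
    (sum-single +-0-commutativeMonoid e (λ q → step p q δ k))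
    where
    term : ∀ q → (step p q (ending e q) k when R q) ≡ (if does (q ≟ e) then step p q δ k else 0ℚ)
    term q with q ≟ e
    ... | yes refl rewrite Re = refl
    ... | no _ = when-zero (R q) (op-zero (step-linear p q) (λ _ → refl) k)
  F-ending-last e (suc r) R p Re k = sum-cong-≗ term
    where
    swap : ∀ q x → ((R ∖ q) ∖ e) x ≡ ((R ∖ e) ∖ q) x
    swap q x with R x | does (x ≟ q) | does (x ≟ e)
    ... | false | _     | _     = refl
    ... | true  | true  | true  = refl
    ... | true  | true  | false = refl
    ... | true  | false | true  = refl
    ... | true  | false | false = refl
    term : ∀ q → (step p q (F (ending e) (suc r) (R ∖ q) q) k when R q)
               ≡ (step p q (F (λ q → step q e δ) r ((R ∖ e) ∖ q) q) k when (R ∖ e) q)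
    term q with q ≟ e
    ... | yes refl rewrite Re = op-zero (step-linear p q) (F-ending-absent q r (R ∖ q) q (∖-self R q)) k
    ... | no q≢e with R q
    ...   | false = refl
    ...   | true  = op-cong (step-linear p q) (λ j → trans
              (F-ending-last e r (R ∖ q) q (trans (∖-other R q (λ e≡q → q≢e (sym e≡q))) Re) j)
              (F-cong (λ _ _ → refl) (swap q) r q j)) k

  F-closing : ∀ c r R p → F (λ q → step q c δ) r R p
            ≗ₛ (λ k → sh (F (λ _ → δ) r R p) k + Q (F (ending (prev c)) r R p) k)
  F-closing c r R p k = begin
    F (λ q → step q c δ) r R p k
      ≡⟨ F-cong closing (λ _ → refl) r p k ⟩
    F (λ q k → sh δ k + Q (ending (prev c) q) k) r R p k
      ≡⟨ F-+ (λ _ → sh δ) (λ q → Q (ending (prev c) q)) r R p k ⟩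
    F (λ _ → sh δ) r R p k + F (λ q → Q (ending (prev c) q)) r R p k
      ≡⟨ cong₂ _+_ (F-op sh-linear (λ _ _ → refl) (λ f k → sym (Q-sh f k)) (λ _ → δ) r R p k)
                   (F-op Q-linear Q-sh (λ _ _ → refl) (ending (prev c)) r R p k) ⟩
    sh (F (λ _ → δ) r R p) k + Q (F (ending (prev c)) r R p) k ∎
    where
    same : ∀ q → does (c ≟ next q) ≡ does (q ≟ prev c)
    same q with c ≟ next q
    ... | yes refl = sym (dec-true (q ≟ prev c) (sym (prev-next q)))
    ... | no c≢    = sym (dec-false (q ≟ prev c) (λ { refl → c≢ (sym (next-prev c)) }))
    closing : ∀ q k → step q c δ k ≡ sh δ k + Q (ending (prev c) q) k
    closing q k = cong (sh δ k +_) (trans (cong (Q δ k when_) (same q))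
      (sym (when-linear Q-linear (does (q ≟ prev c)) δ k)))

  -- In the cyclic order, R is the open interval from p to c.
  F-interval : ∀ r R p c → R p ≡ false → R c ≡ false →
               (∀ x → R x ≡ true → R (prev x) ≡ true ⊎ prev x ≡ p) → R (prev c) ≡ true ⊎ prev c ≡ p →
               count R ≡ r → F (λ q → step q c δ) r R p ≗ₛ C (suc r)
  F-interval zero R p c Rp Rc initial (inj₁ Rpc) cR k with trans (sym Rpc) (count≡0 R cR (prev c))
  ... | ()
  -- Nothing lies between p and c, so closing is a succession; its weight u + (1-u) is `C 1`, which
  -- explains the start `C zero` = δ.
  F-interval zero R p c Rp Rc initial (inj₂ refl) cR k
    rewrite dec-true (c ≟ next (prev c)) (sym (next-prev c)) = refl
  -- Impossible: a letter of `R` preceded by p would be c, so every letter of `R` would have its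
  -- predecessor in `R`.
  F-interval (suc r) R p c Rp Rc initial (inj₂ refl) cR k with nonempty R cR
  ... | x , Rx = contradiction (count-empty (unjoined R) none) (unjoined-exists R p x Rp Rx)
    where
    none : ∀ y → unjoined R y ≡ false
    none y with R y in Ry
    ... | false = refl
    ... | true with initial y Ry
    ...   | inj₁ Rpy rewrite Rpy = refl
    ...   | inj₂ e with trans (sym Ry) (trans (cong R (trans (sym (next-prev y)) (trans (cong next e) (next-prev c)))) Rc)
    ...     | ()
  F-interval (suc r) R p c Rp Rc initial (inj₁ Rpc) cR k = begin
    F (λ q → step q c δ) (suc r) R p k
      ≡⟨ F-closing c (suc r) R p k ⟩
    sh (F (λ _ → δ) (suc r) R p) k + Q (F (ending (prev c)) (suc r) R p) k
      ≡⟨ cong₂ _+_ (op-cong sh-linear (F-δ (suc r) R p Rp cR 0 (suc r) (trans one (sym (ℕ.+-identityʳ _))) total) k)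
                   (op-cong Q-linear (λ j → trans (F-ending-last (prev c) r R p Rpc j) (rest j)) k) ⟩
    C (suc (suc r)) k ∎
    where
    -- In an interval that starts after p only `next p` can be unjoined, and it may follow p. Hence
    -- d = 0 and t is the full length.
    one : count (unjoined R) ≡ b→ℕ (R (next p))
    one = trans (sumℕ-cong pointwise) (count-single (next p) R)
      where
      pointwise : ∀ x → b→ℕ (unjoined R x) ≡ (if does (x ≟ next p) then b→ℕ (R x) else 0)
      pointwise x with x ≟ next p
      ... | yes refl rewrite prev-next p | Rp with R (next p)
      ...   | true  = refl
      ...   | false = refl
      pointwise x | no x≢ with R x in Rx
      ... | false = refl
      ... | true with initial x Rx
      ...   | inj₁ Rpx rewrite Rpx = refl
      ...   | inj₂ e = contradiction (trans (sym (next-prev x)) (cong next e)) x≢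
    total : count (joined R) ℕ.+ b→ℕ (R (next p)) ≡ suc r
    total = trans (cong (count (joined R) ℕ.+_) (sym one)) (trans (sym (split R)) cR)
    -- The open interval from p to `prev c`, where `prev c` is the new closing letter.
    R′ = R ∖ prev c
    ⊆ : ∀ x → R′ x ≡ true → R x ≡ true
    ⊆ x e with R x
    ... | true = refl
    kept : ∀ x → R x ≡ true → x ≢ c → R (prev x) ≡ true ⊎ prev x ≡ p → R′ (prev x) ≡ true ⊎ prev x ≡ p
    kept x Rx x≢c (inj₂ e) = inj₂ e
    kept x Rx x≢c (inj₁ e) = inj₁ (trans (∖-other R (prev c)
      (λ e′ → x≢c (trans (sym (next-prev x)) (trans (cong next e′) (next-prev c))))) e)
    in≢ : ∀ x → R x ≡ true → x ≢ c
    in≢ x Rx refl with trans (sym Rx) Rc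
    ... | ()
    rest : F (λ q → step q (prev c) δ) r R′ p ≗ₛ C (suc r)
    rest = F-interval r R′ p (prev c) R′p (∖-self R (prev c))
      (λ x R′x → kept x (⊆ x R′x) (in≢ x (⊆ x R′x)) (initial x (⊆ x R′x)))
      (kept (prev c) Rpc (in≢ (prev c) Rpc) (initial (prev c) Rpc))
      (ℕ.suc-injective (trans (sym (count-remove R (prev c) Rpc)) cR))
      where
      R′p : R′ p ≡ false
      R′p rewrite Rp = refl

-- Coefficients of the right-hand side

Σ≤-cong : ∀ n {f g} → (∀ i → i ℕ.≤ n → f i ≡ g i) → Σ≤ n f ≡ Σ≤ n g
Σ≤-cong zero    e = e 0 z≤n
Σ≤-cong (suc n) e = cong₂ _+_ (Σ≤-cong n (λ i i≤n → e i (ℕ.m≤n⇒m≤1+n i≤n))) (e (suc n) ℕ.≤-refl)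

Σ≤-head : ∀ n f → Σ≤ (suc n) f ≡ f 0 + Σ≤ n (λ i → f (suc i))
Σ≤-head zero    f = refl
Σ≤-head (suc n) f = trans (cong (_+ f (suc (suc n))) (Σ≤-head n f)) (+-assoc (f 0) _ _)

Σ≤-+ : ∀ n f g → Σ≤ n (λ i → f i + g i) ≡ Σ≤ n f + Σ≤ n g
Σ≤-+ zero    f g = refl
Σ≤-+ (suc n) f g = trans (cong (_+ (f (suc n) + g (suc n))) (Σ≤-+ n f g))
  (solve 4 (λ a b c d → (a :+ b) :+ (c :+ d) := (a :+ c) :+ (b :+ d)) refl (Σ≤ n f) (Σ≤ n g) (f (suc n)) (g (suc n)))

Σ≤-* : ∀ n c f → Σ≤ n (λ i → c * f i) ≡ c * Σ≤ n f
Σ≤-* zero    c f = refl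
Σ≤-* (suc n) c f = trans (cong (_+ c * f (suc n)) (Σ≤-* n c f)) (sym (*-distribˡ-+ c (Σ≤ n f) (f (suc n))))

Σ≤-zero : ∀ n {f} → (∀ i → i ℕ.≤ n → f i ≡ 0ℚ) → Σ≤ n f ≡ 0ℚ
Σ≤-zero zero    e = e 0 z≤n
Σ≤-zero (suc n) e = cong₂ _+_ (Σ≤-zero n (λ i i≤n → e i (ℕ.m≤n⇒m≤1+n i≤n))) (e (suc n) ℕ.≤-refl)

Σ≤-only : ∀ n i {f} → i ℕ.≤ n → (∀ j → j ℕ.≤ n → j ≢ i → f j ≡ 0ℚ) → Σ≤ n f ≡ f i
Σ≤-only zero    .0 z≤n e = refl
Σ≤-only (suc n) i {f} i≤n e with i ℕ.≟ suc n
... | yes refl = trans (cong (_+ f (suc n)) (Σ≤-zero n (λ j j≤n → e j (ℕ.m≤n⇒m≤1+n j≤n) (ℕ.<⇒≢ (s≤s j≤n))))) (+-identityˡ _)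
... | no i≢    = trans (cong₂ _+_ (Σ≤-only n i (ℕ.≤-pred (ℕ.≤∧≢⇒< i≤n i≢)) (λ j j≤n → e j (ℕ.m≤n⇒m≤1+n j≤n)))
                                  (e (suc n) ℕ.≤-refl (λ s → i≢ (sym s)))) (+-identityʳ _)

Σ≤-linear : ∀ {op} → Linear op → ∀ n (f : ℕ → Series) →
            op (λ k → Σ≤ n (λ i → f i k)) ≗ₛ (λ k → Σ≤ n (λ i → op (f i) k))
Σ≤-linear      L zero    f k = refl
Σ≤-linear {op} L (suc n) f k = trans (op-+ L (λ k → Σ≤ n (λ i → f i k)) (f (suc n)) k)
  (cong (_+ op (f (suc n)) k) (Σ≤-linear L n f k))

linear-Q : ∀ {op} → Linear op → ∀ f → op (Q f) ≗ₛ (λ k → op f k + - op (sh f) k)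
linear-Q {op} L f k = begin
  op (Q f) k                             ≡⟨ op-cong L (λ k → cong (f k +_) (minus (sh f k))) k ⟩
  op (λ k → f k + - 1ℚ * sh f k) k       ≡⟨ op-+ L f (λ k → - 1ℚ * sh f k) k ⟩
  op f k + op (λ k → - 1ℚ * sh f k) k    ≡⟨ cong (op f k +_) (op-* L (- 1ℚ) (sh f) k) ⟩
  op f k + - 1ℚ * op (sh f) k            ≡⟨ cong (op f k +_) (sym (minus (op (sh f) k))) ⟩
  op f k + - op (sh f) k                 ∎
  where
  minus : ∀ x → - x ≡ - 1ℚ * x
  minus = solve 1 (λ x → :- x := con (- 1ℚ) :* x) refl

-- Multiplication in u alone. The z^n-coefficient of `f ⊗ g` is by definition the sum over i ≤ n of
-- `conv (f i) (g (n ∸ i))`, so two-variable products can be treated one power of z at a time.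
conv : Series → Series → Series
conv f g k = Σ≤ k (λ j → f j * g (k ℕ.∸ j))

conv-linearˡ : ∀ g → Linear (λ f → conv f g)
conv-linearˡ g .op-cong e k = Σ≤-cong k (λ j _ → cong (_* g (k ℕ.∸ j)) (e j))
conv-linearˡ g .op-+ f f′ k = trans (Σ≤-cong k (λ j _ → *-distribʳ-+ (g (k ℕ.∸ j)) (f j) (f′ j))) (Σ≤-+ k _ _)
conv-linearˡ g .op-* c f k = trans (Σ≤-cong k (λ j _ → *-assoc c (f j) (g (k ℕ.∸ j)))) (Σ≤-* k c _)

conv-linearʳ : ∀ f → Linear (conv f)
conv-linearʳ f .op-cong e k = Σ≤-cong k (λ j _ → cong (f j *_) (e (k ℕ.∸ j)))
conv-linearʳ f .op-+ g g′ k = trans (Σ≤-cong k (λ j _ → *-distribˡ-+ (f j) (g (k ℕ.∸ j)) (g′ (k ℕ.∸ j)))) (Σ≤-+ k _ _)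
conv-linearʳ f .op-* c g k = trans
  (Σ≤-cong k (λ j _ → solve 3 (λ a b c → a :* (b :* c) := b :* (a :* c)) refl (f j) c (g (k ℕ.∸ j)))) (Σ≤-* k c _)

conv-zeroˡ : ∀ {f} → f ≗ₛ (λ _ → 0ℚ) → ∀ g → conv f g ≗ₛ (λ _ → 0ℚ)
conv-zeroˡ e g k = Σ≤-zero k (λ j _ → trans (cong (_* g (k ℕ.∸ j)) (e j)) (*-zeroˡ (g (k ℕ.∸ j))))

conv-zeroʳ : ∀ f {g} → g ≗ₛ (λ _ → 0ℚ) → conv f g ≗ₛ (λ _ → 0ℚ)
conv-zeroʳ f e k = Σ≤-zero k (λ j _ → trans (cong (f j *_) (e (k ℕ.∸ j))) (*-zeroʳ (f j)))

conv-δˡ : ∀ g → conv δ g ≗ₛ g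
conv-δˡ g k = trans (Σ≤-only k 0 z≤n off) (*-identityˡ (g k))
  where
  off : ∀ j → j ℕ.≤ k → j ≢ 0 → δ j * g (k ℕ.∸ j) ≡ 0ℚ
  off zero    _ j≢0 = contradiction refl j≢0
  off (suc j) _ _   = *-zeroˡ (g (k ℕ.∸ suc j))

conv-shˡ : ∀ f g → conv (sh f) g ≗ₛ sh (conv f g)
conv-shˡ f g zero    = *-zeroˡ (g 0)
conv-shˡ f g (suc k) = trans (Σ≤-head k (λ j → sh f j * g (suc k ℕ.∸ j)))
  (trans (cong (_+ conv f g k) (*-zeroˡ (g (suc k)))) (+-identityˡ _))

conv-Qˡ : ∀ f g → conv (Q f) g ≗ₛ Q (conv f g)
conv-Qˡ f g k = trans (linear-Q (conv-linearˡ g) f k) (cong (λ x → conv f g k + - x) (conv-shˡ f g k))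

conv-δʳ : ∀ f → conv f δ ≗ₛ f
conv-δʳ f k = trans (Σ≤-only k k ℕ.≤-refl off)
  (trans (cong (λ d → f k * δ d) (ℕ.n∸n≡0 k)) (*-identityʳ (f k)))
  where
  off : ∀ j → j ℕ.≤ k → j ≢ k → f j * δ (k ℕ.∸ j) ≡ 0ℚ
  off j j≤k j≢k with k ℕ.∸ j | ℕ.m<n⇒0<n∸m (ℕ.≤∧≢⇒< j≤k j≢k)
  ... | suc _ | _ = *-zeroʳ (f j)

conv-shʳ : ∀ f g → conv f (sh g) ≗ₛ sh (conv f g)
conv-shʳ f g zero    = *-zeroʳ (f 0)
conv-shʳ f g (suc k) = trans (cong₂ _+_
    (Σ≤-cong k (λ j j≤k → cong (λ d → f j * sh g d) (ℕ.+-∸-assoc 1 j≤k)))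
    (trans (cong (λ d → f (suc k) * sh g d) (ℕ.n∸n≡0 k)) (*-zeroʳ (f (suc k)))))
  (+-identityʳ _)

conv-Qδʳ : ∀ f → conv f (Q δ) ≗ₛ Q f
conv-Qδʳ f k = trans (linear-Q (conv-linearʳ f) δ k)
  (cong₂ (λ x y → x + - y) (conv-δʳ f k) (trans (conv-shʳ f δ k) (op-cong sh-linear (conv-δʳ f) k)))

iter-conv : ∀ {op} → Linear op → (∀ f g → conv (op f) g ≗ₛ op (conv f g)) →
            ∀ n g → conv (iter op n δ) g ≗ₛ iter op n g
iter-conv L comm zero    g = conv-δˡ g
iter-conv L comm (suc n) g k = trans (comm _ g k) (op-cong L (iter-conv L comm n g) k)

𝟙-zero : 𝟙 0 ≗ₛ δ
𝟙-zero zero    = refl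
𝟙-zero (suc k) = refl

u-zero : u 0 ≗ₛ sh δ
u-zero zero          = refl
u-zero (suc zero)    = refl
u-zero (suc (suc k)) = refl

⊗-zˡ-zero : ∀ f → (z ⊗ f) 0 ≗ₛ (λ _ → 0ℚ)
⊗-zˡ-zero f = conv-zeroˡ (λ _ → refl) (f 0)

⊗-zˡ-suc : ∀ f n → (z ⊗ f) (suc n) ≗ₛ f n
⊗-zˡ-suc f n k = trans (Σ≤-only (suc n) 1 (s≤s z≤n) off)
  (trans (op-cong (conv-linearˡ (f n)) z-one k) (conv-δˡ (f n) k))
  where
  z-one : z 1 ≗ₛ δ
  z-one zero    = refl
  z-one (suc k) = refl
  off : ∀ j → j ℕ.≤ suc n → j ≢ 1 → conv (z j) (f (suc n ℕ.∸ j)) k ≡ 0ℚ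
  off zero          _ _   = conv-zeroˡ (λ _ → refl) (f (suc n)) k
  off (suc zero)    _ j≢1 = contradiction refl j≢1
  off (suc (suc j)) _ _   = conv-zeroˡ (λ _ → refl) (f (suc n ℕ.∸ suc (suc j))) k

⊗-uˡ : ∀ f n → (u ⊗ f) n ≗ₛ sh (f n)
⊗-uˡ f n k = trans (Σ≤-only n 0 z≤n off)
  (trans (op-cong (conv-linearˡ (f n)) u-zero k) (trans (conv-shˡ δ (f n) k) (op-cong sh-linear (conv-δˡ (f n)) k)))
  where
  off : ∀ j → j ℕ.≤ n → j ≢ 0 → conv (u j) (f (n ℕ.∸ j)) k ≡ 0ℚ
  off zero    _ j≢0 = contradiction refl j≢0
  off (suc j) _ _   = conv-zeroˡ (λ _ → refl) (f (n ℕ.∸ suc j)) k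

𝟙⊖u-zero : (𝟙 ⊖ u) 0 ≗ₛ Q δ
𝟙⊖u-zero k = cong₂ (λ x y → x + - y) (𝟙-zero k) (u-zero k)

⊗-1-uʳ : ∀ f n → (f ⊗ (𝟙 ⊖ u)) n ≗ₛ Q (f n)
⊗-1-uʳ f n k = trans (Σ≤-only n n ℕ.≤-refl off)
  (trans (cong (λ d → conv (f n) ((𝟙 ⊖ u) d) k) (ℕ.n∸n≡0 n))
    (trans (op-cong (conv-linearʳ (f n)) 𝟙⊖u-zero k) (conv-Qδʳ (f n) k)))
  where
  off : ∀ j → j ℕ.≤ n → j ≢ n → conv (f j) ((𝟙 ⊖ u) (n ℕ.∸ j)) k ≡ 0ℚ
  off j j≤n j≢n with n ℕ.∸ j | ℕ.m<n⇒0<n∸m (ℕ.≤∧≢⇒< j≤n j≢n)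
  ... | suc _ | _ = conv-zeroʳ (f j) (λ _ → refl) k

-- A = a z where multiplication by the series a in u is the operator op.
record Monomial (A : FPS) (op : Series → Series) : Set where
  field
    linear     : Linear op
    at-zero    : A 0 ≗ₛ (λ _ → 0ℚ)
    at-one     : ∀ g → conv (A 1) g ≗ₛ op g
    at-suc-suc : ∀ n → A (suc (suc n)) ≗ₛ (λ _ → 0ℚ)

inv! : ℕ → ℚ
inv! m = ((ℤ.+ 1) / (m !)) {{m !≢0}}

module _ {A op} (M : Monomial A op) where
  open Monomial M

  ⊗-monomialˡ-suc : ∀ f n → (A ⊗ f) (suc n) ≗ₛ op (f n)
  ⊗-monomialˡ-suc f n k = trans (Σ≤-only (suc n) 1 (s≤s z≤n) off) (at-one (f n) k)
    where
    off : ∀ j → j ℕ.≤ suc n → j ≢ 1 → conv (A j) (f (suc n ℕ.∸ j)) k ≡ 0ℚ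
    off zero          _ _   = conv-zeroˡ at-zero (f (suc n)) k
    off (suc zero)    _ j≢1 = contradiction refl j≢1
    off (suc (suc j)) _ _   = conv-zeroˡ (at-suc-suc j) (f (suc n ℕ.∸ suc (suc j))) k

  -- The m-th power of a z is a^m z^m. Together with the vanishing off the diagonal, this leaves one
  -- term in each sum defining the exponential, the geometric series and the logarithm.
  power-diagonal : ∀ m → (A ^ₛ m) m ≗ₛ iter op m δ
  power-diagonal zero    = 𝟙-zero
  power-diagonal (suc m) k = trans (⊗-monomialˡ-suc (A ^ₛ m) m k) (op-cong linear (power-diagonal m) k)

  power-off-diagonal : ∀ m n → n ≢ m → (A ^ₛ m) n ≗ₛ (λ _ → 0ℚ)
  power-off-diagonal zero    zero    n≢m k = contradiction refl n≢m
  power-off-diagonal zero    (suc n) n≢m k = refl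
  power-off-diagonal (suc m) zero    n≢m k = conv-zeroˡ at-zero ((A ^ₛ m) 0) k
  power-off-diagonal (suc m) (suc n) n≢m k = trans (⊗-monomialˡ-suc (A ^ₛ m) n k)
    (op-zero linear (power-off-diagonal m n (λ e → n≢m (cong suc e))) k)

  exp-coefficient : ∀ n → expₛ A n ≗ₛ (λ k → inv! n * iter op n δ k)
  exp-coefficient n k = trans
    (Σ≤-only n n ℕ.≤-refl (λ j _ j≢n → trans (cong (inv! j *_) (power-off-diagonal j n (λ e → j≢n (sym e)) k)) (*-zeroʳ (inv! j))))
    (cong (inv! n *_) (power-diagonal n k))

  geom-coefficient : ∀ n → geom A n ≗ₛ iter op n δ
  geom-coefficient n k = trans
    (Σ≤-only n n ℕ.≤-refl (λ j _ j≢n → power-off-diagonal j n (λ e → j≢n (sym e)) k))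
    (power-diagonal n k)

  neglog-coefficient : ∀ n → neglog1m A (suc n) ≗ₛ (λ k → ((ℤ.+ 1) / suc n) * iter op (suc n) δ k)
  neglog-coefficient n k = trans
    (Σ≤-only (suc n) (suc n) ℕ.≤-refl (λ { zero _ _ → refl ; (suc j) _ j≢n →
      trans (cong (((ℤ.+ 1) / suc j) *_) (power-off-diagonal (suc j) (suc n) (λ e → j≢n (sym e)) k)) (*-zeroʳ ((ℤ.+ 1) / suc j)) }))
    (cong (((ℤ.+ 1) / suc n) *_) (power-diagonal (suc n) k))

z⟨1-u⟩ : Monomial (z ⊗ (𝟙 ⊖ u)) Q
z⟨1-u⟩ = record
  { linear     = Q-linear
  ; at-zero    = ⊗-zˡ-zero (𝟙 ⊖ u)
  ; at-one     = λ g k → trans (op-cong (conv-linearˡ g) (λ j → trans (⊗-zˡ-suc (𝟙 ⊖ u) 0 j) (𝟙⊖u-zero j)) k)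
                         (trans (conv-Qˡ δ g k) (op-cong Q-linear (conv-δˡ g) k))
  ; at-suc-suc = λ n → ⊗-zˡ-suc (𝟙 ⊖ u) (suc n)
  }

zu : Monomial (z ⊗ u) sh
zu = record
  { linear     = sh-linear
  ; at-zero    = ⊗-zˡ-zero u
  ; at-one     = λ g k → trans (op-cong (conv-linearˡ g) (λ j → trans (⊗-zˡ-suc u 0 j) (u-zero j)) k)
                         (trans (conv-shˡ δ g k) (op-cong sh-linear (conv-δˡ g) k))
  ; at-suc-suc = λ n → ⊗-zˡ-suc u (suc n)
  }

inv!-suc : ∀ m → ι (suc m) * inv! (suc m) ≡ inv! m
inv!-suc m = begin
  a * c′                       ≡⟨ sym (*-identityʳ (a * c′)) ⟩
  a * c′ * 1ℚ                  ≡⟨ cong (a * c′ *_) (sym (ι-inverse (m !) {{m !≢0}})) ⟩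
  a * c′ * (b * inv! m)        ≡⟨ solve 4 (λ a c b d → a :* c :* (b :* d) := (a :* b) :* c :* d) refl a c′ b (inv! m) ⟩
  a * b * c′ * inv! m          ≡⟨ cong (λ x → x * c′ * inv! m) (sym (ι-* (suc m) (m !))) ⟩
  ι (suc m !) * c′ * inv! m    ≡⟨ cong (_* inv! m) (ι-inverse (suc m !) {{suc m !≢0}}) ⟩
  1ℚ * inv! m                  ≡⟨ *-identityˡ (inv! m) ⟩
  inv! m                       ∎
  where
  a = ι (suc m)
  b = ι (m !)
  c′ = inv! (suc m)

-- The coefficients of z^m in 1 - log(1 - zu), e^{z(1-u)} / (1 - zu) and e^{z(1-u)} (1 - log(1 - zu)).
log-part : ℕ → Series
log-part zero    = δ
log-part (suc n) = λ k → ((ℤ.+ 1) / suc n) * iter sh (suc n) δ k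

X Y : ℕ → Series
X m k = Σ≤ m (λ i → inv! i * iter Q i (iter sh (m ℕ.∸ i) δ) k)
Y m k = Σ≤ m (λ i → inv! i * iter Q i (log-part (m ℕ.∸ i)) k)

iter-Q-commute : ∀ {op} → (∀ f → Q (op f) ≗ₛ op (Q f)) → Linear op → ∀ n f → iter Q n (op f) ≗ₛ op (iter Q n f)
iter-Q-commute comm L zero    f k = refl
iter-Q-commute comm L (suc n) f k = trans (op-cong Q-linear (iter-Q-commute comm L n f) k) (comm (iter Q n f) k)

Σ≤-linear-* : ∀ {op} → Linear op → ∀ n (c : ℕ → ℚ) (f : ℕ → Series) →
              op (λ k → Σ≤ n (λ i → c i * f i k)) ≗ₛ (λ k → Σ≤ n (λ i → c i * op (f i) k))
Σ≤-linear-* L n c f k = trans (Σ≤-linear L n (λ i k → c i * f i k) k) (Σ≤-cong n (λ i _ → op-* L (c i) (f i) k))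

RHS-zero : RHS 0 ≗ₛ (λ _ → 0ℚ)
RHS-zero = ⊗-zˡ-zero (expₛ (z ⊗ (𝟙 ⊖ u)) ⊗ (((𝟙 ⊕ neglog1m (z ⊗ u)) ⊗ (𝟙 ⊖ u)) ⊕ (u ⊗ geom (z ⊗ u))))

-- The leading z shifts the index by one. Distributing the exponential over the bracket gives u
-- times the series of `X` plus 1-u times the series of `Y`.
RHS-suc : ∀ m → RHS (suc m) ≗ₛ (λ k → sh (X m) k + Q (Y m) k)
RHS-suc m k = begin
  RHS (suc m) k
    ≡⟨ ⊗-zˡ-suc (E ⊗ B) m k ⟩
  Σ≤ m (λ i → conv (E i) (B (m ℕ.∸ i)) k)
    ≡⟨ Σ≤-cong m (λ i _ → term i (m ℕ.∸ i)) ⟩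
  Σ≤ m (λ i → inv! i * sh (iter Q i (iter sh (m ℕ.∸ i) δ)) k + inv! i * Q (iter Q i (log-part (m ℕ.∸ i))) k)
    ≡⟨ Σ≤-+ m _ _ ⟩
  Σ≤ m (λ i → inv! i * sh (iter Q i (iter sh (m ℕ.∸ i) δ)) k) + Σ≤ m (λ i → inv! i * Q (iter Q i (log-part (m ℕ.∸ i))) k)
    ≡⟨ sym (cong₂ _+_ (Σ≤-linear-* sh-linear m inv! (λ i → iter Q i (iter sh (m ℕ.∸ i) δ)) k)
                      (Σ≤-linear-* Q-linear m inv! (λ i → iter Q i (log-part (m ℕ.∸ i))) k)) ⟩
  sh (X m) k + Q (Y m) k ∎
  where
  E = expₛ (z ⊗ (𝟙 ⊖ u))
  L = 𝟙 ⊕ neglog1m (z ⊗ u)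
  G = geom (z ⊗ u)
  B = (L ⊗ (𝟙 ⊖ u)) ⊕ (u ⊗ G)
  L-coefficient : ∀ n → L n ≗ₛ log-part n
  L-coefficient zero    k = trans (+-identityʳ (𝟙 0 k)) (𝟙-zero k)
  L-coefficient (suc n) k = trans (+-identityˡ _) (neglog-coefficient zu n k)
  B-coefficient : ∀ n → B n ≗ₛ (λ k → sh (iter sh n δ) k + Q (log-part n) k)
  B-coefficient n k = trans (cong₂ _+_
      (trans (⊗-1-uʳ L n k) (op-cong Q-linear (L-coefficient n) k))
      (trans (⊗-uˡ G n k) (op-cong sh-linear (geom-coefficient zu n) k)))
    (+-comm (Q (log-part n) k) (sh (iter sh n δ) k))
  term : ∀ i n → conv (E i) (B n) k ≡ inv! i * sh (iter Q i (iter sh n δ)) k + inv! i * Q (iter Q i (log-part n)) k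
  term i n = begin
    conv (E i) (B n) k
      ≡⟨ op-cong (conv-linearˡ (B n)) (exp-coefficient z⟨1-u⟩ i) k ⟩
    conv (λ k → inv! i * iter Q i δ k) (B n) k
      ≡⟨ op-* (conv-linearˡ (B n)) (inv! i) (iter Q i δ) k ⟩
    inv! i * conv (iter Q i δ) (B n) k
      ≡⟨ cong (inv! i *_) (trans (iter-conv Q-linear conv-Qˡ i (B n) k) (op-cong (iter-linear Q-linear i) (B-coefficient n) k)) ⟩
    inv! i * iter Q i (λ k → sh (iter sh n δ) k + Q (log-part n) k) k
      ≡⟨ cong (inv! i *_) (op-+ (iter-linear Q-linear i) (sh (iter sh n δ)) (Q (log-part n)) k) ⟩
    inv! i * (iter Q i (sh (iter sh n δ)) k + iter Q i (Q (log-part n)) k)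
      ≡⟨ *-distribˡ-+ (inv! i) (iter Q i (sh (iter sh n δ)) k) (iter Q i (Q (log-part n)) k) ⟩
    inv! i * iter Q i (sh (iter sh n δ)) k + inv! i * iter Q i (Q (log-part n)) k
      ≡⟨ cong₂ (λ x y → inv! i * x + inv! i * y)
               (iter-Q-commute Q-sh sh-linear i (iter sh n δ) k) (iter-Q-commute (λ _ _ → refl) Q-linear i (log-part n) k) ⟩
    inv! i * sh (iter Q i (iter sh n δ)) k + inv! i * Q (iter Q i (log-part n)) k ∎

-- Coefficient form of (1 - zu) X = e^{z(1-u)}.
X-suc : ∀ m k → X (suc m) k ≡ sh (X m) k + inv! (suc m) * iter Q (suc m) δ k
X-suc m k = cong₂ _+_
  (trans (Σ≤-cong m (λ i i≤m → cong (inv! i *_) (trans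
      (cong (λ d → iter Q i (iter sh d δ) k) (ℕ.+-∸-assoc 1 i≤m))
      (iter-Q-commute Q-sh sh-linear i (iter sh (m ℕ.∸ i) δ) k))))
    (sym (Σ≤-linear-* sh-linear m inv! (λ i → iter Q i (iter sh (m ℕ.∸ i) δ)) k)))
  (cong (λ d → inv! (suc m) * iter Q (suc m) (iter sh d δ) k) (ℕ.n∸n≡0 m))

-- Multiplied by (m+1)!, the recursion `X-suc` becomes `D-rec` at d = 0: the exponential contributes
-- (1-u)^(m+1), which is `ρ 0 (suc m)`.
X-D : ∀ m k → ι (m !) * X m k ≡ D 0 m k
X-D zero    k = trans (*-identityˡ (X 0 k)) (*-identityˡ (δ k))
X-D (suc m) k = begin
  ι (suc m !) * X (suc m) k
    ≡⟨ cong (ι (suc m !) *_) (X-suc m k) ⟩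
  ι (suc m !) * (sh (X m) k + inv! (suc m) * iter Q (suc m) δ k)
    ≡⟨ solve 4 (λ a b c d → a :* (b :+ c :* d) := a :* b :+ (a :* c) :* d) refl (ι (suc m !)) (sh (X m) k) (inv! (suc m)) (iter Q (suc m) δ k) ⟩
  ι (suc m !) * sh (X m) k + ι (suc m !) * inv! (suc m) * iter Q (suc m) δ k
    ≡⟨ cong₂ (λ x y → x * sh (X m) k + y * iter Q (suc m) δ k) (ι-* (suc m) (m !)) (ι-inverse (suc m !) {{suc m !≢0}}) ⟩
  ι (suc m) * ι (m !) * sh (X m) k + 1ℚ * iter Q (suc m) δ k
    ≡⟨ cong₂ _+_ (trans (*-assoc (ι (suc m)) (ι (m !)) (sh (X m) k)) (cong (ι (suc m) *_)
         (trans (sym (op-* sh-linear (ι (m !)) (X m) k)) (op-cong sh-linear (X-D m) k)))) (*-identityˡ _) ⟩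
  ι (suc m) * sh (D 0 m) k + iter Q (suc m) δ k
    ≡⟨ cong (_+ iter Q (suc m) δ k) (sym (trans (cong (ι (suc m) * sh (D 0 m) k +_) (*-zeroˡ (sh (D 0 (suc m)) k))) (+-identityʳ (ι (suc m) * sh (D 0 m) k)))) ⟩
  first-letter 0 (suc m) k + iter Q (suc m) δ k
    ≡⟨ sym (D-rec 0 (suc m) k) ⟩
  D 0 (suc m) k ∎

-- Coefficient form of the Leibniz rule for z d/dz applied to the product e^{z(1-u)} (1 - log(1 - zu)).
Y-suc : ∀ m k → ι (suc m) * Y (suc m) k ≡ sh (X m) k + Q (Y m) k
Y-suc m k = begin
  ι (suc m) * Y (suc m) k
    ≡⟨ sym (Σ≤-* (suc m) (ι (suc m)) _) ⟩
  Σ≤ (suc m) (λ i → ι (suc m) * g i)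
    -- The exponent m+1 is split as (m+1-i) + i, the z-degrees in the logarithmic and the
    -- exponential factor.
    ≡⟨ Σ≤-cong (suc m) (λ i i≤ → trans (cong (λ d → ι d * g i) (sym (ℕ.m∸n+n≡m i≤)))
         (trans (cong (_* g i) (ι-+ (suc m ℕ.∸ i) i)) (*-distribʳ-+ (g i) (ι (suc m ℕ.∸ i)) (ι i)))) ⟩
  Σ≤ (suc m) (λ i → ι (suc m ℕ.∸ i) * g i + ι i * g i)
    ≡⟨ Σ≤-+ (suc m) _ _ ⟩
  Σ≤ (suc m) (λ i → ι (suc m ℕ.∸ i) * g i) + Σ≤ (suc m) (λ i → ι i * g i)
    ≡⟨ cong₂ _+_ derive-log derive-exp ⟩
  sh (X m) k + Q (Y m) k ∎
  where
  g : ℕ → ℚ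
  g i = inv! i * iter Q i (log-part (suc m ℕ.∸ i)) k
  log-term : ∀ i n → ι (suc n) * (inv! i * iter Q i (log-part (suc n)) k) ≡ inv! i * sh (iter Q i (iter sh n δ)) k
  log-term i n = begin
    ι (suc n) * (inv! i * iter Q i (log-part (suc n)) k)
      ≡⟨ cong (λ x → ι (suc n) * (inv! i * x)) (op-* (iter-linear Q-linear i) ((ℤ.+ 1) / suc n) (iter sh (suc n) δ) k) ⟩
    ι (suc n) * (inv! i * (((ℤ.+ 1) / suc n) * iter Q i (iter sh (suc n) δ) k))
      ≡⟨ solve 4 (λ a b c d → a :* (b :* (c :* d)) := (a :* c) :* (b :* d)) refl (ι (suc n)) (inv! i) ((ℤ.+ 1) / suc n) (iter Q i (iter sh (suc n) δ) k) ⟩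
    ι (suc n) * ((ℤ.+ 1) / suc n) * (inv! i * iter Q i (iter sh (suc n) δ) k)
      ≡⟨ trans (cong (_* (inv! i * iter Q i (iter sh (suc n) δ) k)) (ι-inverse (suc n))) (*-identityˡ _) ⟩
    inv! i * iter Q i (sh (iter sh n δ)) k
      ≡⟨ cong (inv! i *_) (iter-Q-commute Q-sh sh-linear i (iter sh n δ) k) ⟩
    inv! i * sh (iter Q i (iter sh n δ)) k ∎
  -- The summand i = m+1 belongs to the constant 1 of 1 - log(1 - zu) and dies with the factor 0. In
  -- the others the factor cancels the denominator of the logarithm, and u times the geometric
  -- series is left.
  derive-log : Σ≤ (suc m) (λ i → ι (suc m ℕ.∸ i) * g i) ≡ sh (X m) k
  derive-log = trans (cong₂ _+_
      (Σ≤-cong m (λ i i≤m → trans (cong (λ d → ι d * (inv! i * iter Q i (log-part d) k)) (ℕ.+-∸-assoc 1 i≤m)) (log-term i (m ℕ.∸ i))))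
      (trans (cong (λ d → ι d * g (suc m)) (ℕ.n∸n≡0 m)) (*-zeroˡ (g (suc m)))))
    (trans (+-identityʳ _) (sym (Σ≤-linear-* sh-linear m inv! (λ i → iter Q i (iter sh (m ℕ.∸ i) δ)) k)))
  derive-exp : Σ≤ (suc m) (λ i → ι i * g i) ≡ Q (Y m) k
  derive-exp = trans (Σ≤-head m (λ i → ι i * g i)) (trans (cong₂ _+_ (*-zeroˡ (g 0))
      (Σ≤-cong m (λ i _ → trans (sym (*-assoc (ι (suc i)) (inv! (suc i)) _)) (cong (_* iter Q (suc i) (log-part (m ℕ.∸ i)) k) (inv!-suc i)))))
    (trans (+-identityˡ _) (sym (Σ≤-linear-* Q-linear m inv! (λ i → iter Q i (log-part (m ℕ.∸ i))) k))))

Y-C : ∀ m k → ι (m !) * Y m k ≡ C m k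
Y-C zero    k = trans (*-identityˡ (Y 0 k)) (*-identityˡ (δ k))
Y-C (suc m) k = begin
  ι (suc m !) * Y (suc m) k
    ≡⟨ cong (_* Y (suc m) k) (trans (ι-* (suc m) (m !)) (*-comm (ι (suc m)) (ι (m !)))) ⟩
  ι (m !) * ι (suc m) * Y (suc m) k
    ≡⟨ trans (*-assoc (ι (m !)) (ι (suc m)) (Y (suc m) k)) (cong (ι (m !) *_) (Y-suc m k)) ⟩
  ι (m !) * (sh (X m) k + Q (Y m) k)
    ≡⟨ *-distribˡ-+ (ι (m !)) (sh (X m) k) (Q (Y m) k) ⟩
  ι (m !) * sh (X m) k + ι (m !) * Q (Y m) k
    ≡⟨ cong₂ _+_ (trans (sym (op-* sh-linear (ι (m !)) (X m) k)) (op-cong sh-linear (X-D m) k))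
                 (trans (sym (op-* Q-linear (ι (m !)) (Y m) k)) (op-cong Q-linear (Y-C m) k)) ⟩
  C (suc m) k ∎

-- `RHS-suc` and `Y-suc` have the same right side, so the coefficient is (m+1) times that of `Y`:
-- the theorem's series is z d/dz of the series of `Y`.
RHS-C : ∀ m k → RHS (suc m) k ≡ ι (suc m) * C (suc m) k * inv! (suc m)
RHS-C m k = begin
  RHS (suc m) k                ≡⟨ trans (RHS-suc m k) (sym (Y-suc m k)) ⟩
  a * y                        ≡⟨ sym (*-identityʳ (a * y)) ⟩
  a * y * 1ℚ                   ≡⟨ cong (a * y *_) (sym (ι-inverse (suc m !) {{suc m !≢0}})) ⟩
  a * y * (f * inv! (suc m))   ≡⟨ solve 4 (λ a y f c → a :* y :* (f :* c) := a :* (f :* y) :* c) refl a y f (inv! (suc m)) ⟩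
  a * (f * y) * inv! (suc m)   ≡⟨ cong (λ x → a * x * inv! (suc m)) (Y-C (suc m) k) ⟩
  a * C (suc m) k * inv! (suc m) ∎
  where
  a = ι (suc m)
  y = Y (suc m) k
  f = ι (suc m !)

-- From permutations to words

sumL : ∀ {A : Set} → List A → (A → ℚ) → ℚ
sumL []       f = 0ℚ
sumL (x ∷ xs) f = f x + sumL xs f

sumL-cong : ∀ {A : Set} (xs : List A) {f g} → (∀ x → f x ≡ g x) → sumL xs f ≡ sumL xs g
sumL-cong []       e = refl
sumL-cong (x ∷ xs) e = cong₂ _+_ (e x) (sumL-cong xs e)

sumL-++ : ∀ {A : Set} (xs ys : List A) f → sumL (xs ++ ys) f ≡ sumL xs f + sumL ys f
sumL-++ []       ys f = sym (+-identityˡ _)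
sumL-++ (x ∷ xs) ys f = trans (cong (f x +_) (sumL-++ xs ys f)) (sym (+-assoc (f x) _ _))

sumL-map : ∀ {A B : Set} (h : A → B) xs f → sumL (List.map h xs) f ≡ sumL xs (λ x → f (h x))
sumL-map h []       f = refl
sumL-map h (x ∷ xs) f = cong (f (h x) +_) (sumL-map h xs f)

sumL-concatMap : ∀ {A B : Set} (h : A → List B) xs f → sumL (List.concatMap h xs) f ≡ sumL xs (λ x → sumL (h x) f)
sumL-concatMap h []       f = refl
sumL-concatMap h (x ∷ xs) f = trans (sumL-++ (h x) _ f) (cong (sumL (h x) f +_) (sumL-concatMap h xs f))

sumL-tabulate : ∀ {A : Set} {n} (h : Fin n → A) f → sumL (List.tabulate h) f ≡ sum (λ i → f (h i))
sumL-tabulate {n = zero}  h f = refl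
sumL-tabulate {n = suc n} h f = cong (f (h zero) +_) (sumL-tabulate (λ i → h (suc i)) f)

sumL-allVecs-suc : ∀ m n (f : Vec (Fin n) (suc m) → ℚ) →
  sumL (allVecs (suc m) n) f ≡ sum (λ x → sumL (allVecs m n) (λ v → f (x ∷ v)))
sumL-allVecs-suc m n f = trans (sumL-concatMap (λ x → List.map (x ∷_) (allVecs m n)) (List.allFin n) f)
  (trans (sumL-tabulate (λ i → i) (λ x → sumL (List.map (x ∷_) (allVecs m n)) f))
         (sum-cong-≗ (λ x → sumL-map (x ∷_) (allVecs m n) f)))

sumL-linear : ∀ {A : Set} {op} → Linear op → (xs : List A) (f : A → Series) →
              op (λ k → sumL xs (λ x → f x k)) ≗ₛ (λ k → sumL xs (λ x → op (f x) k))
sumL-linear      L []       f k = op-zero L (λ _ → refl) k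
sumL-linear {op = op} L (x ∷ xs) f k = trans (op-+ L (f x) (λ k → sumL xs (λ x → f x k)) k)
  (cong (op (f x) k +_) (sumL-linear L xs f k))

sumL-when : ∀ {A : Set} (xs : List A) (f : A → ℚ) b → (sumL xs f when b) ≡ sumL xs (λ x → f x when b)
sumL-when xs       f true  = refl
sumL-when []       f false = refl
sumL-when (x ∷ xs) f false = sym (trans (+-identityˡ _) (sym (sumL-when xs f false)))

ι-length-filter : ∀ {A : Set} {P : A → Set} (P? : Decidable P) xs →
                  ι (List.length (List.filter P? xs)) ≡ sumL xs (λ x → 1ℚ when does (P? x))
ι-length-filter P? []       = refl
ι-length-filter P? (x ∷ xs) with does (P? x)
... | true  = cong (1ℚ +_) (ι-length-filter P? xs)
... | false = trans (ι-length-filter P? xs) (sym (+-identityˡ _))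

length-filter-tabulate : ∀ {A : Set} {P : A → Set} (P? : Decidable P) {n} (h : Fin n → A) →
  List.length (List.filter P? (List.tabulate h)) ≡ count (λ i → does (P? (h i)))
length-filter-tabulate P? {zero}  h = refl
length-filter-tabulate P? {suc n} h with does (P? (h zero))
... | true  = cong suc (length-filter-tabulate P? (λ i → h (suc i)))
... | false = length-filter-tabulate P? (λ i → h (suc i))

count-full : ∀ n → count {n} (λ _ → true) ≡ n
count-full zero    = refl
count-full (suc n) = cong suc (count-full n)

iter-sh-δ : ∀ j k → iter sh j δ k ≡ (1ℚ when does (j ℕ.≟ k))
iter-sh-δ zero    zero    = refl
iter-sh-δ zero    (suc k) = refl
iter-sh-δ (suc j) zero    = refl
iter-sh-δ (suc j) (suc k) = iter-sh-δ j k

lookup-∷ʳ-< : ∀ {A : Set} {m} (v : Vec A m) c (a : Fin (suc m)) j → toℕ a ≡ toℕ j → lookup (v ∷ʳ c) a ≡ lookup v j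
lookup-∷ʳ-< (x ∷ v) c zero    zero    e = refl
lookup-∷ʳ-< (x ∷ v) c (suc a) (suc j) e = lookup-∷ʳ-< v c a j (ℕ.suc-injective e)

lookup-∷ʳ-last : ∀ {A : Set} {m} (v : Vec A m) c (a : Fin (suc m)) → toℕ a ≡ m → lookup (v ∷ʳ c) a ≡ c
lookup-∷ʳ-last []      c zero    e = refl
lookup-∷ʳ-last (x ∷ v) c (suc a) e = lookup-∷ʳ-last v c a (ℕ.suc-injective e)

-- The cycle `cyc`, its inverse and its single orbit

cyc-< : ∀ {m} (a : Fin (suc m)) → toℕ a ℕ.< m → toℕ (cyc a) ≡ suc (toℕ a)
cyc-< {m} a a<m = trans (toℕ-fromℕ< (m%n<n (suc (toℕ a)) (suc m))) (m<n⇒m%n≡m (s≤s a<m))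

cyc-last : ∀ {m} (a : Fin (suc m)) → toℕ a ≡ m → cyc a ≡ zero
cyc-last {m} a e = toℕ-injective (trans (toℕ-fromℕ< (m%n<n (suc (toℕ a)) (suc m)))
  (trans (cong (λ j → suc j % suc m) e) (n%n≡0 (suc m))))

last? : ∀ {m} (a : Fin (suc m)) → toℕ a ℕ.< m ⊎ toℕ a ≡ m
last? a = ℕ.m≤n⇒m<n∨m≡n (ℕ.≤-pred (toℕ<n a))

cyc⁻¹ : ∀ {m} → Fin (suc m) → Fin (suc m)
cyc⁻¹ {m} zero = fromℕ m
cyc⁻¹ (suc j)  = inject₁ j

cyc-cyc⁻¹ : ∀ {m} (x : Fin (suc m)) → cyc (cyc⁻¹ x) ≡ x
cyc-cyc⁻¹ {m} zero = cyc-last (fromℕ m) (toℕ-fromℕ m)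
cyc-cyc⁻¹ (suc j) = toℕ-injective (trans (cyc-< (inject₁ j) (subst (ℕ._< _) (sym (toℕ-inject₁ j)) (toℕ<n j)))
                                         (cong suc (toℕ-inject₁ j)))

cyc⁻¹-cyc : ∀ {m} (x : Fin (suc m)) → cyc⁻¹ (cyc x) ≡ x
cyc⁻¹-cyc {m} x with last? x
... | inj₂ e = trans (cong cyc⁻¹ (cyc-last x e)) (toℕ-injective (trans (toℕ-fromℕ m) (sym e)))
... | inj₁ x<m with cyc x | cyc-< x x<m
...   | suc j | e = toℕ-injective (trans (toℕ-inject₁ j) (ℕ.suc-injective e))

-- Climb from p to the last element, wrap around to `zero`, and climb from there to x.
cyc-reach : ∀ {m} (P : Fin (suc m) → Set) → (∀ x → P x → P (cyc x)) → ∀ p → P p → ∀ x → P x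
cyc-reach {m} P closed p Pp x = from-zero (toℕ x) x refl
  where
  to-zero : ∀ d a → toℕ a ℕ.+ d ≡ m → P a → P zero
  to-zero zero    a e Pa = subst P (cyc-last a (trans (sym (ℕ.+-identityʳ _)) e)) (closed a Pa)
  to-zero (suc d) a e Pa = to-zero d (cyc a) (trans (cong (ℕ._+ d) (cyc-< a a<m)) e′) (closed a Pa)
    where
    e′ : suc (toℕ a) ℕ.+ d ≡ m
    e′ = trans (sym (ℕ.+-suc (toℕ a) d)) e
    a<m : toℕ a ℕ.< m
    a<m = subst (toℕ a ℕ.<_) e′ (ℕ.m≤m+n (suc (toℕ a)) d)
  from-zero : ∀ j y → toℕ y ≡ j → P y
  from-zero _       zero    e = to-zero (m ℕ.∸ toℕ p) p (ℕ.m+[n∸m]≡n (ℕ.≤-pred (toℕ<n p))) Pp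
  from-zero (suc j) (suc y) e = subst P (cyc-cyc⁻¹ (suc y))
    (closed (inject₁ y) (from-zero j (inject₁ y) (trans (toℕ-inject₁ y) (ℕ.suc-injective e))))

-- Precomposition with the cycle rotates the word: s v becomes v s. The wrap-around position
-- therefore compares the last letter with s.
lookup-cyc : ∀ {A : Set} {m} s (v : Vec A m) a → lookup (s ∷ v) (cyc a) ≡ lookup (v ∷ʳ s) a
lookup-cyc s v a with last? a
... | inj₂ e = trans (cong (lookup (s ∷ v)) (cyc-last a e)) (sym (lookup-∷ʳ-last v s a e))
... | inj₁ a<m with cyc a | cyc-< a a<m
...   | suc j | e = sym (lookup-∷ʳ-< v s a j (sym (ℕ.suc-injective e)))

module _ {m : ℕ} where
  private n = suc m
  open Words {n} cyc cyc⁻¹ cyc⁻¹-cyc cyc-cyc⁻¹ cyc-reach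

  -- Distinctness is tested by deleting used letters, in step with the recursion of `F`.
  distinct-in : ∀ {r} → FinSet → Vec (Fin n) r → Bool
  distinct-in R []      = true
  distinct-in R (x ∷ v) = R x ∧ distinct-in (R ∖ x) v

  break : Fin n → Fin n → Bool
  break p q = not (does (q ≟ cyc p))

  breaks : ∀ {r} → Fin n → Fin n → Vec (Fin n) r → ℕ
  breaks c p []      = b→ℕ (break p c)
  breaks c p (x ∷ v) = b→ℕ (break p x) ℕ.+ breaks c x v

  -- For a succession, u f + (1-u) f collapses to f. So the split weight of `step` really is u to
  -- the number of breaks.
  step-sh : ∀ p q f → step p q f ≗ₛ iter sh (b→ℕ (break p q)) f
  step-sh p q f k with does (q ≟ cyc p)
  ... | true  = solve 2 (λ a b → a :+ (b :+ :- a) := b) refl (sh f k) (f k)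
  ... | false = +-identityʳ _

  F-words : ∀ c r R p → F (λ q → step q c δ) r R p
          ≗ₛ (λ k → sumL (allVecs r n) (λ v → iter sh (breaks c p v) δ k when distinct-in R v))
  F-words c zero    R p k = trans (step-sh p c δ k) (sym (+-identityʳ _))
  F-words c (suc r) R p k = sym (trans (sumL-allVecs-suc r n _) (sum-cong-≗ (λ x → sym (term x))))
    where
    iter-b : ∀ b j f → iter sh (b→ℕ b) (iter sh j f) ≗ₛ iter sh (b→ℕ b ℕ.+ j) f
    iter-b true  j f k = refl
    iter-b false j f k = refl
    when-∧ : ∀ y a b → ((y when b) when a) ≡ (y when (a ∧ b))
    when-∧ y true  b = refl
    when-∧ y false b = refl
    term : ∀ x → (step p x (F (λ q → step q c δ) r (R ∖ x) x) k when R x)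
         ≡ sumL (allVecs r n) (λ v → iter sh (b→ℕ (break p x) ℕ.+ breaks c x v) δ k when (R x ∧ distinct-in (R ∖ x) v))
    term x = begin
      (step p x (F (λ q → step q c δ) r (R ∖ x) x) k when R x)
        ≡⟨ cong (_when R x) (trans (op-cong (step-linear p x) (F-words c r (R ∖ x) x) k) (sumL-linear (step-linear p x) (allVecs r n) g k)) ⟩
      (sumL (allVecs r n) (λ v → step p x (g v) k) when R x)
        ≡⟨ sumL-when (allVecs r n) _ (R x) ⟩
      sumL (allVecs r n) (λ v → step p x (g v) k when R x)
        ≡⟨ sumL-cong (allVecs r n) (λ v → trans
             (cong (_when R x) (trans (when-linear (step-linear p x) (distinct-in (R ∖ x) v) (iter sh (breaks c x v) δ) k)
               (cong (_when distinct-in (R ∖ x) v) (trans (step-sh p x (iter sh (breaks c x v) δ) k) (iter-b (break p x) (breaks c x v) δ k)))))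
             (when-∧ (iter sh (b→ℕ (break p x) ℕ.+ breaks c x v) δ k) (R x) (distinct-in (R ∖ x) v))) ⟩
      sumL (allVecs r n) (λ v → iter sh (b→ℕ (break p x) ℕ.+ breaks c x v) δ k when (R x ∧ distinct-in (R ∖ x) v)) ∎
      where
      g : Vec (Fin n) r → Series
      g v k = iter sh (breaks c x v) δ k when distinct-in (R ∖ x) v

  breaks-count : ∀ {r} c p (v : Vec (Fin n) r) → breaks c p v ≡ count (λ a → break (lookup (p ∷ v) a) (lookup (v ∷ʳ c) a))
  breaks-count c p []      = sym (ℕ.+-identityʳ _)
  breaks-count c p (x ∷ v) = cong (b→ℕ (break p x) ℕ.+_) (breaks-count c x v)

  H-breaks : ∀ s (v : Vec (Fin n) m) → H (lookup (s ∷ v) ∘ₚ cyc) (cyc ∘ₚ lookup (s ∷ v)) ≡ breaks s s v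
  H-breaks s v = trans (length-filter-tabulate (λ a → ¬? (lookup (s ∷ v) (cyc a) ≟ cyc (lookup (s ∷ v) a))) (λ i → i))
    (trans (sumℕ-cong (λ a → cong (λ x → b→ℕ (break (lookup (s ∷ v) a) x)) (lookup-cyc s v a))) (sym (breaks-count s s v)))

  Distinct : ∀ {r} → Vec (Fin n) r → Set
  Distinct v = ∀ i j → lookup v i ≡ lookup v j → i ≡ j

  ∧-true : ∀ {a b} → a ∧ b ≡ true → a ≡ true × b ≡ true
  ∧-true {true} {true} e = refl , refl

  ∖-true : ∀ R x y → (R ∖ x) y ≡ true → R y ≡ true × y ≢ x
  ∖-true R x y e with y ≟ x | R y
  ... | no y≢x | true = refl , y≢x

  distinct-in-sound : ∀ {r} R (v : Vec (Fin n) r) → distinct-in R v ≡ true → (∀ i → R (lookup v i) ≡ true) × Distinct v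
  distinct-in-sound R []      e = (λ ()) , λ ()
  distinct-in-sound R (x ∷ v) e with ∧-true {R x} e
  ... | Rx , e′ with distinct-in-sound (R ∖ x) v e′
  ... | inR , distinct = inR′ , distinct′
    where
    inR′ : ∀ i → R (lookup (x ∷ v) i) ≡ true
    inR′ zero    = Rx
    inR′ (suc i) = proj₁ (∖-true R x (lookup v i) (inR i))
    distinct′ : Distinct (x ∷ v)
    distinct′ zero    zero    _  = refl
    distinct′ zero    (suc j) x≡ = contradiction (sym x≡) (proj₂ (∖-true R x (lookup v j) (inR j)))
    distinct′ (suc i) zero    ≡x = contradiction ≡x (proj₂ (∖-true R x (lookup v i) (inR i)))
    distinct′ (suc i) (suc j) e  = cong suc (distinct i j e)

  distinct-in-complete : ∀ {r} R (v : Vec (Fin n) r) → (∀ i → R (lookup v i) ≡ true) → Distinct v → distinct-in R v ≡ true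
  distinct-in-complete R []      inR distinct = refl
  distinct-in-complete R (x ∷ v) inR distinct rewrite inR zero = distinct-in-complete (R ∖ x) v
    (λ i → trans (∖-other R x (λ e → contradiction (distinct (suc i) zero e) λ ())) (inR (suc i)))
    (λ i j e → suc-injective (distinct (suc i) (suc j) e))

  isPerm-distinct : (w : Vec (Fin n) n) → does (isPerm? (lookup w)) ≡ distinct-in (λ _ → true) w
  isPerm-distinct w with distinct-in (λ _ → true) w in e
  ... | true  = dec-true (isPerm? (lookup w)) (proj₂ (distinct-in-sound (λ _ → true) w e))
  ... | false = dec-false (isPerm? (lookup w)) λ inj → contradiction
                  (trans (sym e) (distinct-in-complete (λ _ → true) w (λ _ → refl) inj)) λ ()

  T-C : ∀ k → ι (T k n) ≡ ι n * C n k
  T-C k = begin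
    ι (T k n)
      ≡⟨ ι-length-filter _ (allVecs n n) ⟩
    sumL (allVecs n n) (λ w → 1ℚ when (does (isPerm? (lookup w)) ∧ does (H (lookup w ∘ₚ cyc) (cyc ∘ₚ lookup w) ℕ.≟ k)))
      ≡⟨ sumL-allVecs-suc m n _ ⟩
    sum (λ s → sumL (allVecs m n) (λ v → 1ℚ when (does (isPerm? (lookup (s ∷ v))) ∧ does (H (lookup (s ∷ v) ∘ₚ cyc) (cyc ∘ₚ lookup (s ∷ v)) ℕ.≟ k))))
      ≡⟨ sum-cong-≗ (λ s → sumL-cong (allVecs m n) (word s)) ⟩
    sum (λ s → sumL (allVecs m n) (λ v → iter sh (breaks s s v) δ k when distinct-in (others s) v))
      ≡⟨ sum-cong-≗ (λ s → trans (sym (F-words s m (others s) s k)) (F-others s)) ⟩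
    sum {n} (λ s → C n k)
      ≡⟨ trans (sum-when-const {n} (C n k) (λ _ → true)) (cong (λ d → ι d * C n k) (count-full n)) ⟩
    ι n * C n k ∎
    where
    others : Fin n → FinSet
    others s = (λ _ → true) ∖ s
    word : ∀ s (v : Vec (Fin n) m) →
      (1ℚ when (does (isPerm? (lookup (s ∷ v))) ∧ does (H (lookup (s ∷ v) ∘ₚ cyc) (cyc ∘ₚ lookup (s ∷ v)) ℕ.≟ k)))
      ≡ (iter sh (breaks s s v) δ k when distinct-in (others s) v)
    word s v = trans (cong₂ (λ a j → 1ℚ when (a ∧ does (j ℕ.≟ k))) (isPerm-distinct (s ∷ v)) (H-breaks s v))
      (trans (when-∧ (distinct-in (others s) v)) (cong (_when distinct-in (others s) v) (sym (iter-sh-δ (breaks s s v) k))))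
      where
      when-∧ : ∀ a {b} → (1ℚ when (a ∧ b)) ≡ ((1ℚ when b) when a)
      when-∧ true  = refl
      when-∧ false = refl
    -- All letters but s form the open interval from s once round to s. The value is thus the same
    -- for each first letter, which produces the factor n.
    F-others : ∀ s → F (λ q → step q s δ) m (others s) s k ≡ C n k
    F-others s = F-interval m (others s) s s (∖-self _ s) (∖-self _ s) (λ x _ → pred-in x) (pred-in s)
      (ℕ.suc-injective (trans (sym (count-remove (λ _ → true) s refl)) (count-full n))) k
      where
      pred-in : ∀ x → others s (cyc⁻¹ x) ≡ true ⊎ cyc⁻¹ x ≡ s
      pred-in x with cyc⁻¹ x ≟ s
      ... | yes e = inj₂ e
      ... | no _  = inj₁ refl

theorem4 : (n k : ℕ) → LHS n k ≡ RHS n k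
theorem4 zero    k = sym (RHS-zero k)
theorem4 (suc m) k = begin
  LHS (suc m) k                              ≡⟨ /-ι (T k (suc m)) (suc m !) {{suc m !≢0}} ⟩
  ι (T k (suc m)) * inv! (suc m)             ≡⟨ cong (_* inv! (suc m)) (T-C {m} k) ⟩
  ι (suc m) * C (suc m) k * inv! (suc m)    ≡⟨ sym (RHS-C m k) ⟩
  RHS (suc m) k                              ∎
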